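{- Let $n,k$ be positive integers and let $\mathcal F\subset\binom{[n]}{k}$ be an intersecting family. If $n\ge 2k+2$, then $\delta(\mathcal F)\le \binom{n-2}{k-2}$. More generally, if $t$ is an integer with $1\le t<k$ and $n\ge 2k+\frac{3t}{1-\frac tk}$, then $\delta_t(\mathcal F)\le \binom{n-t-1}{k-t-1}$.
   Context: $[n]=\{1,\dots,n\}$ and $\binom{[n]}{k}$ is the set of $k$-element subsets of $[n]$. A family $\mathcal F$ is intersecting if any two of its sets intersect. For a set $S\subset[n]$, its degree in $\mathcal F$ is the number of sets of $\mathcal F$ containing $S$. $\delta_t(\mathcal F)$ is the minimum degree of a $t$-element subset $S\subset[n]$, and $\delta(\mathcal F)=\delta_1(\mathcal F)$ is the minimum degree of an element of $[n]$ (the number of sets of $\mathcal F$ containing that element). -}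

module Defs where

open import Data.Nat using (ℕ; zero; suc; _⊓_; _≟_)
open import Data.Integer using (ℤ; +_; -[1+_])
open import Data.Nat.Combinatorics using (_C_)
open import Data.Bool using (true; false)
open import Data.List using (List; []; _∷_; _++_; map; filter; length)
open import Data.Vec using (_∷_; [])
open import Data.Fin.Subset using (Subset; _∩_; Nonempty; ∣_∣; _⊆_)
open import Data.Fin.Subset.Properties using (_⊆?_)
open import Data.List.Relation.Unary.All using (All)
open import Data.List.Relation.Unary.Unique.Propositional using (Unique)
open import Data.List.Membership.Propositional using (_∈_)
open import Relation.Binary.PropositionalEquality using (_≡_)

-- A family of subsets of [n] = Fin n, given as a duplicate-free list.
Family : ℕ → Set
Family n = List (Subset n)

IsSet : ∀ {n} → Family n → Set
IsSet F = Unique F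

Uniform : ∀ {n} → ℕ → Family n → Set
Uniform k F = All (λ A → ∣ A ∣ ≡ k) F

Intersecting : ∀ {n} → Family n → Set
Intersecting F = ∀ {A B} → A ∈ F → B ∈ F → Nonempty (A ∩ B)

degree : ∀ {n} → Family n → Subset n → ℕ
degree F S = length (filter (S ⊆?_) F)

allSubsets : (n : ℕ) → List (Subset n)
allSubsets zero = [] ∷ []
allSubsets (suc n) = map (false ∷_) (allSubsets n) ++ map (true ∷_) (allSubsets n)

tSubsets : (n t : ℕ) → List (Subset n)
tSubsets n t = filter (λ S → ∣ S ∣ ≟ t) (allSubsets n)

-- minimum of a nonempty list (value 0 on the empty list, never used here)
minimum : List ℕ → ℕ
minimum [] = 0
minimum (x ∷ []) = x
minimum (x ∷ y ∷ xs) = x ⊓ minimum (y ∷ xs)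

δₜ : ∀ {n} → ℕ → Family n → ℕ
δₜ {n} t F = minimum (map (degree F) (tSubsets n t))

δ : ∀ {n} → Family n → ℕ
δ F = δₜ 1 F

binom : ℕ → ℤ → ℕ
binom m (+ j) = m C j
binom m -[1+ _ ] = 0

{-# OPTIONS --safe #-}
module Submission where

-- Put T_m(x,y) = Σ_{|S|=m} (Σ_{A ⊇ S} x(A)) (Σ_{B ∩ S = ∅} y(B)) and let f be the indicator of F. If all t-degrees
-- exceeded D = C(n-t-1,k-t-1), then T_t(f,f) would exceed D C(n-k,t) |F|, while T_k(f,f) = 0 because F is
-- intersecting. For a suitable constant β the quadratic form D C(n-k,t) ⟪x,x⟫ - T_t(x,x) + β T_k(x,x) vanishes on the
-- span of the stars A ↦ [i ∈ A], on both sides, so it suffices that it is nonnegative on the weights with all degrees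
-- zero (a Hoffman-type argument). For those, the commutator ∂ U - U ∂ = n - 2|S| of the up and down operators and
-- Cauchy-Schwarz give |T_m(x,x)| ≤ C(k-2,m-2) C(n-m-2,k-2) ⟪x,x⟫, which is small enough as soon as
-- k(k-1) + t(t-1) ≤ (k-t)(n-k-1); each of the two hypotheses on n implies this.

open import Defs

-- All arithmetic stays in the integers: the projection onto the stars is scaled by its denominator,
-- and each use of Cauchy-Schwarz expands one square with explicit coefficients. The constant that
-- results would involve a square root; `C-exchange` shows that the root is rational. The constant β
-- is C(n-t-1,k-1) C(k,t) / C(n-k-1,k-1). It is the only value for which the total weight of f drops
-- out of the form on the stars; Pascal's rule then removes the remaining term. The form has the
-- right leading constant because D C(n-k,t) = C(n-t-1,k-1) C(k-1,t). Sums over sets disjoint from S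
-- are superset sums of the complemented weight, so T_m is an inner product of two superset sums and
-- only their norms have to be bounded. Zero degrees make both vanish on level 1, and the norms are
-- compared level by level from there. On weights with zero degrees the bounds for T_t and T_k
-- require t(t-1)/(n-t-1) + k(k-1)/(n-k-1) ≤ k-t. Replacing n-t-1 by the smaller n-k-1 gives the
-- condition of the overview.

module Weights where

  open import Data.Bool using (true; false)
  open import Data.Fin.Subset using (Subset; ∣_∣; ∁; ⊤; _⊆_)
  open import Data.Fin.Subset.Properties using (_⊆?_; drop-∷-⊆; s⊆s; out⊆; x∈p∩q⁻; x∈∁p⇒x∉p)
  open import Data.Integer hiding (∣_∣; suc; pred)
  open import Data.Integer.Properties
  open import Data.Integer.Tactic.RingSolver using (solve-∀)
  open import Data.List using (List; []; _∷_; length; map)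
  open import Data.List.Membership.Propositional using (_∈_)
  open import Data.List.Membership.Propositional.Properties using (∈-map⁺; ∈-++⁺ˡ; ∈-++⁺ʳ; ∈-filter⁺)
  open import Data.List.Relation.Unary.All as All using ()
  open import Data.List.Relation.Unary.AllPairs using ([]; _∷_)
  open import Data.List.Relation.Unary.Any using (here; there)
  open import Data.Nat as ℕ using (ℕ; zero; suc; pred; _!)
  open import Data.Nat.Combinatorics using (_C_; nC1≡n; nCn≡1; nCk≡nC[n∸k]; nCk≡n!/k![n-k]!; k![n∸k]!∣n!; nCk+nC[k+1]≡[n+1]C[k+1])
  open import Data.Nat.DivMod using (m/n*n≡m)
  import Data.Nat.Properties as ℕₚ
  open import Data.Nat.Tactic.RingSolver using () renaming (solve-∀ to ℕ-solve-∀)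
  open import Data.Product using (_×_; _,_; ∃; proj₁; proj₂)
  open import Data.Sum using (_⊎_; inj₁; inj₂)
  open import Data.Vec as Vec using (Vec; []; _∷_)
  open import Function using (_∘_)
  open import Relation.Binary.PropositionalEquality
  open import Relation.Nullary using (¬_; yes; no; contradiction)

  private
    variable
      n : ℕ

  -- Binomial coefficients

  -- Writing the upper index as a sum keeps truncated subtraction and division out of the identities
  -- below, each of which is proved by clearing factorials.
  C-factorial : ∀ i j → ((i ℕ.+ j) C i) ℕ.* (i ! ℕ.* j !) ≡ (i ℕ.+ j) !
  C-factorial i j = trans
    (cong₂ ℕ._*_ (nCk≡n!/k![n-k]! i≤) (sym eq))
    (m/n*n≡m {{ℕₚ.m*n≢0 (i !) ((i ℕ.+ j ℕ.∸ i) !) {{ℕₚ._!≢0 i}} {{ℕₚ._!≢0 (i ℕ.+ j ℕ.∸ i)}}}} (k![n∸k]!∣n! i≤))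
    where
    i≤ = ℕₚ.m≤m+n i j
    eq : i ! ℕ.* (i ℕ.+ j ℕ.∸ i) ! ≡ i ! ℕ.* j !
    eq = cong (λ d → i ! ℕ.* d !) (ℕₚ.m+n∸m≡n i j)

  factorials-nonZero : ∀ i j → ℕ.NonZero (i ! ℕ.* j !)
  factorials-nonZero i j = ℕₚ.m*n≢0 (i !) (j !) {{ℕₚ._!≢0 i}} {{ℕₚ._!≢0 j}}

  C-shift : ∀ i j → suc i ℕ.* (suc (i ℕ.+ j) C suc i) ≡ suc j ℕ.* (suc (i ℕ.+ j) C i)
  C-shift i j = ℕₚ.*-cancelʳ-≡ _ _ (i ! ℕ.* j !) {{factorials-nonZero i j}} (begin
    suc i ℕ.* (suc (i ℕ.+ j) C suc i) ℕ.* (i ! ℕ.* j !)   ≡⟨ lhs (suc i) (suc (i ℕ.+ j) C suc i) (i !) (j !) ⟩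
    (suc (i ℕ.+ j) C suc i) ℕ.* (suc i ! ℕ.* j !)         ≡⟨ C-factorial (suc i) j ⟩
    suc (i ℕ.+ j) !                                       ≡⟨ cong _! (ℕₚ.+-suc i j) ⟨
    (i ℕ.+ suc j) !                                       ≡⟨ C-factorial i (suc j) ⟨
    ((i ℕ.+ suc j) C i) ℕ.* (i ! ℕ.* suc j !)             ≡⟨ cong (λ s → (s C i) ℕ.* (i ! ℕ.* suc j !)) (ℕₚ.+-suc i j) ⟩
    (suc (i ℕ.+ j) C i) ℕ.* (i ! ℕ.* suc j !)             ≡⟨ rhs (suc j) (suc (i ℕ.+ j) C i) (i !) (j !) ⟩
    suc j ℕ.* (suc (i ℕ.+ j) C i) ℕ.* (i ! ℕ.* j !)       ∎)
    where
    open ≡-Reasoning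
    lhs : ∀ s c a b → s ℕ.* c ℕ.* (a ℕ.* b) ≡ c ℕ.* (s ℕ.* a ℕ.* b)
    lhs = ℕ-solve-∀
    rhs : ∀ s c a b → c ℕ.* (a ℕ.* (s ℕ.* b)) ≡ s ℕ.* c ℕ.* (a ℕ.* b)
    rhs = ℕ-solve-∀

  C-absorb : ∀ i j → suc (i ℕ.+ j) ℕ.* ((i ℕ.+ j) C i) ≡ suc i ℕ.* (suc (i ℕ.+ j) C suc i)
  C-absorb i j = ℕₚ.*-cancelʳ-≡ _ _ (i ! ℕ.* j !) {{factorials-nonZero i j}} (begin
    suc (i ℕ.+ j) ℕ.* ((i ℕ.+ j) C i) ℕ.* (i ! ℕ.* j !)   ≡⟨ ℕₚ.*-assoc (suc (i ℕ.+ j)) ((i ℕ.+ j) C i) (i ! ℕ.* j !) ⟩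
    suc (i ℕ.+ j) ℕ.* (((i ℕ.+ j) C i) ℕ.* (i ! ℕ.* j !)) ≡⟨ cong (suc (i ℕ.+ j) ℕ.*_) (C-factorial i j) ⟩
    suc (i ℕ.+ j) !                                       ≡⟨ C-factorial (suc i) j ⟨
    (suc (i ℕ.+ j) C suc i) ℕ.* (suc i ! ℕ.* j !)         ≡⟨ rhs (suc i) (suc (i ℕ.+ j) C suc i) (i !) (j !) ⟩
    suc i ℕ.* (suc (i ℕ.+ j) C suc i) ℕ.* (i ! ℕ.* j !)   ∎)
    where
    open ≡-Reasoning
    rhs : ∀ s c a b → c ℕ.* (s ℕ.* a ℕ.* b) ≡ s ℕ.* c ℕ.* (a ℕ.* b)
    rhs = ℕ-solve-∀

  C-nonZero : ∀ i j → ℕ.NonZero ((i ℕ.+ j) C i)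
  C-nonZero i j = ℕₚ.m*n≢0⇒m≢0 ((i ℕ.+ j) C i) {i ! ℕ.* j !} {{subst ℕ.NonZero (sym (C-factorial i j)) (ℕₚ._!≢0 (i ℕ.+ j))}}

  C-sym : ∀ i j → (i ℕ.+ j) C i ≡ (i ℕ.+ j) C j
  C-sym i j = trans (nCk≡nC[n∸k] (ℕₚ.m≤m+n i j)) (cong ((i ℕ.+ j) C_) (ℕₚ.m+n∸m≡n i j))

  C-absorbʳ : ∀ i j → suc (i ℕ.+ j) ℕ.* ((i ℕ.+ j) C i) ≡ suc j ℕ.* (suc (i ℕ.+ j) C suc j)
  C-absorbʳ i j = trans (cong (suc (i ℕ.+ j) ℕ.*_) (C-sym i j))
    (subst (λ s → suc s ℕ.* (s C j) ≡ suc j ℕ.* (suc s C suc j)) (ℕₚ.+-comm j i) (C-absorb j i))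

  -- After multiplication by the factorials both sides become k! k'! q!. The identity makes the
  -- product of the two norm bounds in `T-bound` a perfect square.
  C-exchange : ∀ m j j' a b → m ℕ.+ j ≡ suc (suc a) → m ℕ.+ j' ≡ suc (suc b) → j ℕ.+ b ≡ j' ℕ.+ a →
    suc (suc a) ℕ.* suc a ℕ.* (suc (suc b) C m) ℕ.* ((j ℕ.+ b) C j)
      ≡ suc (suc b) ℕ.* suc b ℕ.* (suc (suc a) C m) ℕ.* ((j ℕ.+ b) C j')
  C-exchange m j j' a b k≡ k'≡ q≡ = ℕₚ.*-cancelʳ-≡ _ _ (m ! ℕ.* (j ! ℕ.* j' !) ℕ.* (a ! ℕ.* b !))
    {{ℕₚ.m*n≢0 _ (a ! ℕ.* b !) {{ℕₚ.m*n≢0 (m !) _ {{ℕₚ._!≢0 m}} {{factorials-nonZero j j'}}}} {{factorials-nonZero a b}}}} (begin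
    k ℕ.* suc a ℕ.* (k' C m) ℕ.* (q C j) ℕ.* (m ! ℕ.* (j ! ℕ.* j' !) ℕ.* (a ! ℕ.* b !))
      ≡⟨ gather k (suc a) (k' C m) (q C j) (m !) (j !) (j' !) (a !) (b !) ⟩
    k ! ℕ.* ((k' C m) ℕ.* (m ! ℕ.* j' !)) ℕ.* ((q C j) ℕ.* (j ! ℕ.* b !))
      ≡⟨ cong₂ (λ x y → k ! ℕ.* x ℕ.* y) (fact m j' k'≡) (C-factorial j b) ⟩
    k ! ℕ.* k' ! ℕ.* q !
      ≡⟨ cong (ℕ._* q !) (ℕₚ.*-comm (k !) (k' !)) ⟩
    k' ! ℕ.* k ! ℕ.* q !
      ≡⟨ cong₂ (λ x y → k' ! ℕ.* x ℕ.* y) (fact m j k≡) (fact j' a (sym q≡)) ⟨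
    k' ! ℕ.* ((k C m) ℕ.* (m ! ℕ.* j !)) ℕ.* ((q C j') ℕ.* (j' ! ℕ.* a !))
      ≡⟨ gather′ k' (suc b) (k C m) (q C j') (m !) (j !) (j' !) (a !) (b !) ⟨
    k' ℕ.* suc b ℕ.* (k C m) ℕ.* (q C j') ℕ.* (m ! ℕ.* (j ! ℕ.* j' !) ℕ.* (a ! ℕ.* b !)) ∎)
    where
    open ≡-Reasoning
    k  = suc (suc a)
    k' = suc (suc b)
    q  = j ℕ.+ b
    fact : ∀ i j {s} → i ℕ.+ j ≡ s → (s C i) ℕ.* (i ! ℕ.* j !) ≡ s !
    fact i j refl = C-factorial i j
    gather : ∀ k a₁ c d m j j' a b → k ℕ.* a₁ ℕ.* c ℕ.* d ℕ.* (m ℕ.* (j ℕ.* j') ℕ.* (a ℕ.* b))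
      ≡ k ℕ.* (a₁ ℕ.* a) ℕ.* (c ℕ.* (m ℕ.* j')) ℕ.* (d ℕ.* (j ℕ.* b))
    gather = ℕ-solve-∀
    gather′ : ∀ k b₁ c d m j j' a b → k ℕ.* b₁ ℕ.* c ℕ.* d ℕ.* (m ℕ.* (j ℕ.* j') ℕ.* (a ℕ.* b))
      ≡ k ℕ.* (b₁ ℕ.* b) ℕ.* (c ℕ.* (m ℕ.* j)) ℕ.* (d ℕ.* (j' ℕ.* a))
    gather′ = ℕ-solve-∀

  -- Both sides are the multinomial coefficient of t, j and j'. With t + j = k - 1 and t + j' = n -
  -- k this is C(n-t-1,k-1) C(k-1,t) = C(n-t-1,k-t-1) C(n-k,t).
  C-trinomial : ∀ t j j' → ((t ℕ.+ j ℕ.+ j') C (t ℕ.+ j)) ℕ.* ((t ℕ.+ j) C t) ≡ ((j ℕ.+ (t ℕ.+ j')) C j) ℕ.* ((t ℕ.+ j') C t)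
  C-trinomial t j j' = ℕₚ.*-cancelʳ-≡ _ _ (t ! ℕ.* (j ! ℕ.* j' !)) {{ℕₚ.m*n≢0 (t !) _ {{ℕₚ._!≢0 t}} {{factorials-nonZero j j'}}}} (begin
    c₁ ℕ.* c₂ ℕ.* (t ! ℕ.* (j ! ℕ.* j' !))                  ≡⟨ left c₁ c₂ (t !) (j !) (j' !) ⟩
    c₁ ℕ.* (c₂ ℕ.* (t ! ℕ.* j !) ℕ.* j' !)                  ≡⟨ cong (λ x → c₁ ℕ.* (x ℕ.* j' !)) (C-factorial t j) ⟩
    c₁ ℕ.* ((t ℕ.+ j) ! ℕ.* j' !)                           ≡⟨ C-factorial (t ℕ.+ j) j' ⟩
    (t ℕ.+ j ℕ.+ j') !                                      ≡⟨ cong _! (swap t j j') ⟩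
    (j ℕ.+ (t ℕ.+ j')) !                                    ≡⟨ C-factorial j (t ℕ.+ j') ⟨
    c₃ ℕ.* (j ! ℕ.* (t ℕ.+ j') !)                           ≡⟨ cong (λ x → c₃ ℕ.* (j ! ℕ.* x)) (C-factorial t j') ⟨
    c₃ ℕ.* (j ! ℕ.* (c₄ ℕ.* (t ! ℕ.* j' !)))                ≡⟨ right c₃ c₄ (t !) (j !) (j' !) ⟩
    c₃ ℕ.* c₄ ℕ.* (t ! ℕ.* (j ! ℕ.* j' !))                  ∎)
    where
    open ≡-Reasoning
    c₁ = (t ℕ.+ j ℕ.+ j') C (t ℕ.+ j)
    c₂ = (t ℕ.+ j) C t
    c₃ = (j ℕ.+ (t ℕ.+ j')) C j
    c₄ = (t ℕ.+ j') C t
    swap : ∀ t j j' → t ℕ.+ j ℕ.+ j' ≡ j ℕ.+ (t ℕ.+ j')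
    swap = ℕ-solve-∀
    left : ∀ a b t j j' → a ℕ.* b ℕ.* (t ℕ.* (j ℕ.* j')) ≡ a ℕ.* (b ℕ.* (t ℕ.* j) ℕ.* j')
    left = ℕ-solve-∀
    right : ∀ a b t j j' → a ℕ.* (j ℕ.* (b ℕ.* (t ℕ.* j'))) ≡ a ℕ.* b ℕ.* (t ℕ.* (j ℕ.* j'))
    right = ℕ-solve-∀

  +pascal : ∀ m k → + (m C k) + + (m C suc k) ≡ + (suc m C suc k)
  +pascal m k = trans (sym (pos-+ (m C k) _)) (cong +_ (nCk+nC[k+1]≡[n+1]C[k+1] m k))

  +C0 : ∀ m → + (m C 0) ≡ 1ℤ
  +C0 zero    = refl
  +C0 (suc m) = refl

  -- Integer arithmetic and signs

  +-congˡ : ∀ a {b c} → b ≡ c → a + b ≡ a + c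
  +-congˡ a = cong λ b → a + b

  interchange : ∀ a b c d → (a + b) + (c + d) ≡ (a + c) + (b + d)
  interchange = solve-∀

  0≤i*i : ∀ i → 0ℤ ≤ i * i
  0≤i*i (+ zero)   = ≤-refl
  0≤i*i (+[1+ m ]) = +≤+ ℕ.z≤n
  0≤i*i (-[1+ m ]) = +≤+ ℕ.z≤n

  positive-* : ∀ {x y} → Positive x → Positive y → Positive (x * y)
  positive-* {+[1+ _ ]} {+[1+ _ ]} _ _ = _

  nonNegative-* : ∀ {x y} → 0ℤ ≤ x → 0ℤ ≤ y → 0ℤ ≤ x * y
  nonNegative-* {x} {y} 0≤x 0≤y = subst (_≤ x * y) (*-zeroʳ x) (*-monoˡ-≤-nonNeg x {{nonNegative 0≤x}} 0≤y)

  +C-positive : ∀ {s} i j → i ℕ.+ j ≡ s → Positive (+ (s C i))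
  +C-positive i j refl = positive (+<+ (ℕ.>-nonZero⁻¹ _ {{C-nonZero i j}}))

  -- Weights on the Boolean lattice

  Weight : ℕ → Set
  Weight n = Subset n → ℤ

  ∑ : Weight n → ℤ
  ∑ {zero}  x = x []
  ∑ {suc n} x = ∑ (x ∘ (false ∷_)) + ∑ (x ∘ (true ∷_))

  ind : Subset n → ℕ → ℤ
  ind []          zero    = 1ℤ
  ind []          (suc m) = 0ℤ
  ind (false ∷ S) m       = ind S m
  ind (true ∷ S)  zero    = 0ℤ
  ind (true ∷ S)  (suc m) = ind S m

  -- The zeta transform of the Boolean lattice; `subsetSum` is its transpose.
  supersetSum : Weight n → Weight n
  supersetSum x []          = x []
  supersetSum x (false ∷ S) = supersetSum (x ∘ (false ∷_)) S + supersetSum (x ∘ (true ∷_)) S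
  supersetSum x (true ∷ S)  = supersetSum (x ∘ (true ∷_)) S

  subsetSum : Weight n → Weight n
  subsetSum x []          = x []
  subsetSum x (false ∷ S) = subsetSum (x ∘ (false ∷_)) S
  subsetSum x (true ∷ S)  = subsetSum (x ∘ (false ∷_)) S + subsetSum (x ∘ (true ∷_)) S

  -- ∂ sums over the sets covering S, U over the sets covered by S.
  ∂ : Weight n → Weight n
  ∂ x []          = 0ℤ
  ∂ x (false ∷ S) = ∂ (x ∘ (false ∷_)) S + x (true ∷ S)
  ∂ x (true ∷ S)  = ∂ (x ∘ (true ∷_)) S

  U : Weight n → Weight n
  U x []          = 0ℤ
  U x (false ∷ S) = U (x ∘ (false ∷_)) S
  U x (true ∷ S)  = U (x ∘ (true ∷_)) S + x (false ∷ S)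

  lin : Vec ℤ n → Weight n
  lin []       []          = 0ℤ
  lin (c ∷ cs) (false ∷ S) = lin cs S
  lin (c ∷ cs) (true ∷ S)  = c + lin cs S

  Level : ℕ → Weight n → Set
  Level k x = ∀ A → ∣ A ∣ ≡ k ⊎ x A ≡ 0ℤ

  -- Linearity, complementation and adjointness of the sums

  ∑-cong : {x y : Weight n} → (∀ S → x S ≡ y S) → ∑ x ≡ ∑ y
  ∑-cong {zero}  e = e []
  ∑-cong {suc n} e = cong₂ _+_ (∑-cong (e ∘ (false ∷_))) (∑-cong (e ∘ (true ∷_)))

  ∑-+ : (x y : Weight n) → ∑ (λ S → x S + y S) ≡ ∑ x + ∑ y
  ∑-+ {zero}  x y = refl
  ∑-+ {suc n} x y = trans
    (cong₂ _+_ (∑-+ (x ∘ (false ∷_)) (y ∘ (false ∷_))) (∑-+ (x ∘ (true ∷_)) (y ∘ (true ∷_))))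
    (interchange (∑ (x ∘ (false ∷_))) _ _ _)

  ∑-* : ∀ a (x : Weight n) → ∑ (λ S → a * x S) ≡ a * ∑ x
  ∑-* {zero}  a x = refl
  ∑-* {suc n} a x = trans
    (cong₂ _+_ (∑-* a (x ∘ (false ∷_))) (∑-* a (x ∘ (true ∷_))))
    (sym (*-distribˡ-+ a (∑ (x ∘ (false ∷_))) _))

  ∑-≥0 : {x : Weight n} → (∀ S → 0ℤ ≤ x S) → 0ℤ ≤ ∑ x
  ∑-≥0 {zero}  h = h []
  ∑-≥0 {suc n} h = +-mono-≤ (∑-≥0 (h ∘ (false ∷_))) (∑-≥0 (h ∘ (true ∷_)))

  ∑-mono : {x y : Weight n} → (∀ S → x S ≤ y S) → ∑ x ≤ ∑ y
  ∑-mono {zero}  h = h []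
  ∑-mono {suc n} h = +-mono-≤ (∑-mono (h ∘ (false ∷_))) (∑-mono (h ∘ (true ∷_)))

  ∑-zero : {x : Weight n} → (∀ S → x S ≡ 0ℤ) → ∑ x ≡ 0ℤ
  ∑-zero {zero}  h = h []
  ∑-zero {suc n} h = cong₂ _+_ (∑-zero (h ∘ (false ∷_))) (∑-zero (h ∘ (true ∷_)))

  ∑-∁ : (x : Weight n) → ∑ (x ∘ ∁) ≡ ∑ x
  ∑-∁ {zero}  x = refl
  ∑-∁ {suc n} x = trans
    (cong₂ _+_ (∑-∁ (x ∘ (true ∷_))) (∑-∁ (x ∘ (false ∷_))))
    (+-comm (∑ (x ∘ (true ∷_))) _)

  supersetSum-cong : {x y : Weight n} → (∀ S → x S ≡ y S) → ∀ S → supersetSum x S ≡ supersetSum y S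
  supersetSum-cong e []          = e []
  supersetSum-cong e (false ∷ S) = cong₂ _+_ (supersetSum-cong (e ∘ (false ∷_)) S) (supersetSum-cong (e ∘ (true ∷_)) S)
  supersetSum-cong e (true ∷ S)  = supersetSum-cong (e ∘ (true ∷_)) S

  supersetSum-+ : (x y : Weight n) → ∀ S →
    supersetSum (λ A → x A + y A) S ≡ supersetSum x S + supersetSum y S
  supersetSum-+ x y []          = refl
  supersetSum-+ x y (false ∷ S) = trans
    (cong₂ _+_ (supersetSum-+ (x ∘ (false ∷_)) (y ∘ (false ∷_)) S) (supersetSum-+ (x ∘ (true ∷_)) (y ∘ (true ∷_)) S))
    (interchange (supersetSum (x ∘ (false ∷_)) S) _ _ _)
  supersetSum-+ x y (true ∷ S)  = supersetSum-+ (x ∘ (true ∷_)) (y ∘ (true ∷_)) S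

  supersetSum-* : ∀ a (x : Weight n) S → supersetSum (λ A → a * x A) S ≡ a * supersetSum x S
  supersetSum-* a x []          = refl
  supersetSum-* a x (false ∷ S) = trans
    (cong₂ _+_ (supersetSum-* a (x ∘ (false ∷_)) S) (supersetSum-* a (x ∘ (true ∷_)) S))
    (sym (*-distribˡ-+ a (supersetSum (x ∘ (false ∷_)) S) _))
  supersetSum-* a x (true ∷ S)  = supersetSum-* a (x ∘ (true ∷_)) S

  -- A ⊆ ∁ S iff S ⊆ ∁ A.
  subsetSum-∁ : (x : Weight n) → ∀ S → subsetSum x (∁ S) ≡ supersetSum (x ∘ ∁) S
  subsetSum-∁ x []          = refl
  subsetSum-∁ x (false ∷ S) = trans
    (cong₂ _+_ (subsetSum-∁ (x ∘ (false ∷_)) S) (subsetSum-∁ (x ∘ (true ∷_)) S))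
    (+-comm (supersetSum (x ∘ (false ∷_) ∘ ∁) S) _)
  subsetSum-∁ x (true ∷ S)  = subsetSum-∁ (x ∘ (false ∷_)) S

  supersetSum-∁ : (x : Weight n) → ∀ S → supersetSum x S ≡ subsetSum (x ∘ ∁) (∁ S)
  supersetSum-∁ x []          = refl
  supersetSum-∁ x (false ∷ S) = trans
    (cong₂ _+_ (supersetSum-∁ (x ∘ (false ∷_)) S) (supersetSum-∁ (x ∘ (true ∷_)) S))
    (+-comm (subsetSum (x ∘ (false ∷_) ∘ ∁) (∁ S)) _)
  supersetSum-∁ x (true ∷ S)  = supersetSum-∁ (x ∘ (true ∷_)) S

  subsetSum-cong : {x y : Weight n} → (∀ S → x S ≡ y S) → ∀ S → subsetSum x S ≡ subsetSum y S
  subsetSum-cong e []          = e []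
  subsetSum-cong e (true ∷ S) = cong₂ _+_ (subsetSum-cong (e ∘ (false ∷_)) S) (subsetSum-cong (e ∘ (true ∷_)) S)
  subsetSum-cong e (false ∷ S)  = subsetSum-cong (e ∘ (false ∷_)) S

  subsetSum-+ : (x y : Weight n) → ∀ S →
    subsetSum (λ A → x A + y A) S ≡ subsetSum x S + subsetSum y S
  subsetSum-+ x y []          = refl
  subsetSum-+ x y (true ∷ S) = trans
    (cong₂ _+_ (subsetSum-+ (x ∘ (false ∷_)) (y ∘ (false ∷_)) S) (subsetSum-+ (x ∘ (true ∷_)) (y ∘ (true ∷_)) S))
    (interchange (subsetSum (x ∘ (false ∷_)) S) _ _ _)
  subsetSum-+ x y (false ∷ S)  = subsetSum-+ (x ∘ (false ∷_)) (y ∘ (false ∷_)) S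

  subsetSum-* : ∀ a (x : Weight n) S → subsetSum (λ A → a * x A) S ≡ a * subsetSum x S
  subsetSum-* a x []          = refl
  subsetSum-* a x (true ∷ S) = trans
    (cong₂ _+_ (subsetSum-* a (x ∘ (false ∷_)) S) (subsetSum-* a (x ∘ (true ∷_)) S))
    (sym (*-distribˡ-+ a (subsetSum (x ∘ (false ∷_)) S) _))
  subsetSum-* a x (false ∷ S)  = subsetSum-* a (x ∘ (false ∷_)) S

  ∂-+ : (x y : Weight n) → ∀ S → ∂ (λ A → x A + y A) S ≡ ∂ x S + ∂ y S
  ∂-+ x y []          = refl
  ∂-+ x y (false ∷ S) = trans
    (cong (_+ (x (true ∷ S) + y (true ∷ S))) (∂-+ (x ∘ (false ∷_)) (y ∘ (false ∷_)) S))
    (interchange (∂ (x ∘ (false ∷_)) S) _ _ _)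
  ∂-+ x y (true ∷ S)  = ∂-+ (x ∘ (true ∷_)) (y ∘ (true ∷_)) S

  U-+ : (x y : Weight n) → ∀ S → U (λ A → x A + y A) S ≡ U x S + U y S
  U-+ x y []          = refl
  U-+ x y (false ∷ S) = U-+ (x ∘ (false ∷_)) (y ∘ (false ∷_)) S
  U-+ x y (true ∷ S)  = trans
    (cong (_+ (x (false ∷ S) + y (false ∷ S))) (U-+ (x ∘ (true ∷_)) (y ∘ (true ∷_)) S))
    (interchange (U (x ∘ (true ∷_)) S) _ _ _)

  supersetSum-adjoint : (x y : Weight n) →
    ∑ (λ S → supersetSum x S * y S) ≡ ∑ (λ S → x S * subsetSum y S)
  supersetSum-adjoint {zero}  x y = refl
  supersetSum-adjoint {suc n} x y = begin
    ∑ (λ S → (z₀ S + z₁ S) * y₀ S) + ∑ (λ S → z₁ S * y₁ S)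
      ≡⟨ cong (_+ ∑ (λ S → z₁ S * y₁ S)) (trans (∑-cong λ S → *-distribʳ-+ (y₀ S) (z₀ S) (z₁ S)) (∑-+ (λ S → z₀ S * y₀ S) (λ S → z₁ S * y₀ S))) ⟩
    ∑ (λ S → z₀ S * y₀ S) + ∑ (λ S → z₁ S * y₀ S) + ∑ (λ S → z₁ S * y₁ S)
      ≡⟨ +-assoc (∑ λ S → z₀ S * y₀ S) _ _ ⟩
    ∑ (λ S → z₀ S * y₀ S) + (∑ (λ S → z₁ S * y₀ S) + ∑ (λ S → z₁ S * y₁ S))
      ≡⟨ cong₂ _+_ (supersetSum-adjoint x₀ y₀) (cong₂ _+_ (supersetSum-adjoint x₁ y₀) (supersetSum-adjoint x₁ y₁)) ⟩
    ∑ (λ S → x₀ S * s₀ S) + (∑ (λ S → x₁ S * s₀ S) + ∑ (λ S → x₁ S * s₁ S))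
      ≡⟨ +-congˡ (∑ (λ S → x₀ S * s₀ S)) (trans (∑-cong λ S → *-distribˡ-+ (x₁ S) (s₀ S) (s₁ S)) (∑-+ (λ S → x₁ S * s₀ S) (λ S → x₁ S * s₁ S))) ⟨
    ∑ (λ S → x₀ S * s₀ S) + ∑ (λ S → x₁ S * (s₀ S + s₁ S)) ∎
    where
    open ≡-Reasoning
    x₀ = x ∘ (false ∷_)
    x₁ = x ∘ (true ∷_)
    y₀ = y ∘ (false ∷_)
    y₁ = y ∘ (true ∷_)
    z₀ = supersetSum x₀
    z₁ = supersetSum x₁
    s₀ = subsetSum y₀
    s₁ = subsetSum y₁

  ∂-adjoint : (x y : Weight n) → ∑ (λ S → x S * U y S) ≡ ∑ (λ S → ∂ x S * y S)
  ∂-adjoint {zero}  x y = *-zeroʳ (x [])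
  ∂-adjoint {suc n} x y = begin
    ∑ (λ S → x₀ S * U y₀ S) + ∑ (λ S → x₁ S * (U y₁ S + y₀ S))
      ≡⟨ +-congˡ (∑ (λ S → x₀ S * U y₀ S)) (trans (∑-cong λ S → *-distribˡ-+ (x₁ S) (U y₁ S) (y₀ S)) (∑-+ (λ S → x₁ S * U y₁ S) (λ S → x₁ S * y₀ S))) ⟩
    ∑ (λ S → x₀ S * U y₀ S) + (∑ (λ S → x₁ S * U y₁ S) + ∑ (λ S → x₁ S * y₀ S))
      ≡⟨ cong₂ _+_ (∂-adjoint x₀ y₀) (cong (_+ ∑ (λ S → x₁ S * y₀ S)) (∂-adjoint x₁ y₁)) ⟩
    ∑ (λ S → ∂ x₀ S * y₀ S) + (∑ (λ S → ∂ x₁ S * y₁ S) + ∑ (λ S → x₁ S * y₀ S))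
      ≡⟨ swap (∑ (λ S → ∂ x₀ S * y₀ S)) _ _ ⟩
    ∑ (λ S → ∂ x₀ S * y₀ S) + ∑ (λ S → x₁ S * y₀ S) + ∑ (λ S → ∂ x₁ S * y₁ S)
      ≡⟨ cong (_+ ∑ (λ S → ∂ x₁ S * y₁ S)) (trans (∑-cong λ S → *-distribʳ-+ (y₀ S) (∂ x₀ S) (x₁ S)) (∑-+ (λ S → ∂ x₀ S * y₀ S) (λ S → x₁ S * y₀ S))) ⟨
    ∑ (λ S → (∂ x₀ S + x₁ S) * y₀ S) + ∑ (λ S → ∂ x₁ S * y₁ S) ∎
    where
    open ≡-Reasoning
    x₀ = x ∘ (false ∷_)
    x₁ = x ∘ (true ∷_)
    y₀ = y ∘ (false ∷_)
    y₁ = y ∘ (true ∷_)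
    swap : ∀ a b c → a + (b + c) ≡ a + c + b
    swap = solve-∀

  -- Levels, complements and linear weights

  ∣S∣+∣∁S∣≡n : (S : Subset n) → ∣ S ∣ ℕ.+ ∣ ∁ S ∣ ≡ n
  ∣S∣+∣∁S∣≡n []          = refl
  ∣S∣+∣∁S∣≡n (false ∷ S) = trans (ℕₚ.+-suc ∣ S ∣ ∣ ∁ S ∣) (cong suc (∣S∣+∣∁S∣≡n S))
  ∣S∣+∣∁S∣≡n (true ∷ S)  = cong suc (∣S∣+∣∁S∣≡n S)

  ∣∁S∣≡ : ∀ {m r} (S : Subset n) → m ℕ.+ r ≡ n → ∣ S ∣ ≡ m → ∣ ∁ S ∣ ≡ r
  ∣∁S∣≡ {m = m} S e refl = ℕₚ.+-cancelˡ-≡ m _ _ (trans (∣S∣+∣∁S∣≡n S) (sym e))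

  ind-cong : ∀ (S : Subset n) m {a b} → (∣ S ∣ ≡ m → a ≡ b) → ind S m * a ≡ ind S m * b
  ind-cong []          zero    h = cong (1ℤ *_) (h refl)
  ind-cong []          (suc m) h = refl
  ind-cong (false ∷ S) m       h = ind-cong S m h
  ind-cong (true ∷ S)  zero    h = refl
  ind-cong (true ∷ S)  (suc m) h = ind-cong S m (h ∘ cong suc)

  ind-mono : ∀ (S : Subset n) m {a b} → (∣ S ∣ ≡ m → a ≤ b) → ind S m * a ≤ ind S m * b
  ind-mono []          zero    h = *-monoˡ-≤-nonNeg 1ℤ (h refl)
  ind-mono []          (suc m) h = ≤-refl
  ind-mono (false ∷ S) m       h = ind-mono S m h
  ind-mono (true ∷ S)  zero    h = ≤-refl
  ind-mono (true ∷ S)  (suc m) h = ind-mono S m (h ∘ cong suc)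

  ind-level : ∀ m (S : Subset n) → ∣ S ∣ ≡ m ⊎ ind S m ≡ 0ℤ
  ind-level zero    []          = inj₁ refl
  ind-level (suc m) []          = inj₂ refl
  ind-level m       (false ∷ S) = ind-level m S
  ind-level zero    (true ∷ S)  = inj₂ refl
  ind-level (suc m) (true ∷ S)  with ind-level m S
  ... | inj₁ e = inj₁ (cong suc e)
  ... | inj₂ e = inj₂ e

  ind-≡1 : (S : Subset n) → ind S ∣ S ∣ ≡ 1ℤ
  ind-≡1 []          = refl
  ind-≡1 (false ∷ S) = ind-≡1 S
  ind-≡1 (true ∷ S)  = ind-≡1 S

  ind-∁ : ∀ k k' → k ℕ.+ k' ≡ n → (S : Subset n) → ind (∁ S) k ≡ ind S k'
  ind-∁ k k' e S with ind-level k (∁ S) | ind-level k' S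
  ... | inj₁ a | inj₁ b = trans (subst (λ m → ind (∁ S) m ≡ 1ℤ) a (ind-≡1 (∁ S))) (sym (subst (λ m → ind S m ≡ 1ℤ) b (ind-≡1 S)))
  ... | inj₂ a | inj₂ b = trans a (sym b)
  ... | inj₁ a | inj₂ b = contradiction (trans (sym (subst (λ m → ind S m ≡ 1ℤ) (ℕₚ.+-cancelʳ-≡ k _ _ (trans (trans (cong (∣ S ∣ ℕ.+_) (sym a)) (∣S∣+∣∁S∣≡n S)) (trans (sym e) (ℕₚ.+-comm k k')))) (ind-≡1 S))) b) λ ()
  ... | inj₂ a | inj₁ b = contradiction (trans (sym (subst (λ m → ind (∁ S) m ≡ 1ℤ) (∣∁S∣≡ S (trans (ℕₚ.+-comm k' k) e) b) (ind-≡1 (∁ S)))) a) λ ()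

  level-cong : ∀ {k} {x : Weight n} → Level k x → ∀ A {a b} → (∣ A ∣ ≡ k → a ≡ b) → x A * a ≡ x A * b
  level-cong {x = x} L A {a} {b} h with L A
  ... | inj₁ e = cong (x A *_) (h e)
  ... | inj₂ e = trans (cong (_* a) e) (sym (cong (_* b) e))

  level-∁ : ∀ {k k'} {x : Weight n} → k ℕ.+ k' ≡ n → Level k x → Level k' (x ∘ ∁)
  level-∁ {k = k} {k'} e L A with L (∁ A)
  ... | inj₂ z = inj₂ z
  ... | inj₁ c = inj₁ (ℕₚ.+-cancelʳ-≡ k _ _ (trans (trans (cong (∣ A ∣ ℕ.+_) (sym c)) (∣S∣+∣∁S∣≡n A)) (trans (sym e) (ℕₚ.+-comm k k'))))

  lin-∅ : ∀ (c : Vec ℤ n) A → ∣ A ∣ ≡ 0 → lin c A ≡ 0ℤ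
  lin-∅ []      []          e = refl
  lin-∅ (_ ∷ c) (false ∷ A) e = lin-∅ c A e

  lin-∁ : ∀ (c : Vec ℤ n) A → lin c A + lin c (∁ A) ≡ lin c ⊤
  lin-∁ []      []          = refl
  lin-∁ (a ∷ c) (false ∷ A) = trans (swap (lin c A) a (lin c (∁ A))) (+-congˡ (a) (lin-∁ c A))
    where
    swap : ∀ x y z → x + (y + z) ≡ y + (x + z)
    swap = solve-∀
  lin-∁ (a ∷ c) (true ∷ A)  = trans (+-assoc a (lin c A) _) (+-congˡ (a) (lin-∁ c A))

  subsetSum-zero : (x : Weight n) → ∀ R → (∀ A → A ⊆ R → x A ≡ 0ℤ) → subsetSum x R ≡ 0ℤ
  subsetSum-zero x []          h = h [] (λ {_} y → y)
  subsetSum-zero x (false ∷ R) h = subsetSum-zero (x ∘ (false ∷_)) R λ A → h (false ∷ A) ∘ out⊆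
  subsetSum-zero x (true ∷ R)  h = cong₂ _+_
    (subsetSum-zero (x ∘ (false ∷_)) R λ A → h (false ∷ A) ∘ out⊆)
    (subsetSum-zero (x ∘ (true ∷_)) R λ A → h (true ∷ A) ∘ s⊆s)

  subsetSum-ind : ∀ m (A : Subset n) → subsetSum (λ S → ind S m) A ≡ + (∣ A ∣ C m)
  subsetSum-ind zero    []          = refl
  subsetSum-ind (suc m) []          = refl
  subsetSum-ind m       (false ∷ A) = subsetSum-ind m A
  subsetSum-ind zero    (true ∷ A)  = trans
    (cong₂ _+_ (subsetSum-ind 0 A) (subsetSum-zero (λ _ → 0ℤ) A λ _ _ → refl))
    (trans (+-identityʳ _) (trans (+C0 ∣ A ∣) (sym (+C0 (suc ∣ A ∣)))))
  subsetSum-ind (suc m) (true ∷ A)  = trans (cong₂ _+_ (subsetSum-ind (suc m) A) (subsetSum-ind m A))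
    (trans (+-comm (+ (∣ A ∣ C suc m)) (+ (∣ A ∣ C m))) (+pascal ∣ A ∣ m))

  -- Each element of A lies in C(|A|-1, m) of the (m+1)-subsets of A. The truncated `pred` is
  -- harmless at the empty set, where `lin c` vanishes.
  subsetSum-ind-lin : ∀ m (c : Vec ℤ n) A →
    subsetSum (λ S → ind S (suc m) * lin c S) A ≡ + (pred ∣ A ∣ C m) * lin c A
  subsetSum-ind-lin m []      []          = sym (*-zeroʳ (+ (0 C m)))
  subsetSum-ind-lin m (a ∷ c) (false ∷ A) = subsetSum-ind-lin m c A
  subsetSum-ind-lin m (a ∷ c) (true ∷ A)  = begin
    subsetSum (λ S → ind S (suc m) * lin c S) A + subsetSum (λ S → ind S m * (a + lin c S)) A
      ≡⟨ cong₂ _+_ (subsetSum-ind-lin m c A) (trans (subsetSum-cong (λ S → trans (*-distribˡ-+ (ind S m) a _) (cong (_+ ind S m * lin c S) (*-comm (ind S m) a))) A)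
           (trans (subsetSum-+ (λ S → a * ind S m) (λ S → ind S m * lin c S) A) (cong (_+ _) (trans (subsetSum-* a (λ S → ind S m) A) (cong (a *_) (subsetSum-ind m A)))))) ⟩
    + (pred ∣ A ∣ C m) * lin c A + (a * + (∣ A ∣ C m) + subsetSum (λ S → ind S m * lin c S) A)
      ≡⟨ rearrange (+ (pred ∣ A ∣ C m) * lin c A) a _ _ ⟩
    + (∣ A ∣ C m) * a + (+ (pred ∣ A ∣ C m) * lin c A + subsetSum (λ S → ind S m * lin c S) A)
      ≡⟨ +-congˡ (+ (∣ A ∣ C m) * a) (rest m) ⟩
    + (∣ A ∣ C m) * a + + (∣ A ∣ C m) * lin c A
      ≡⟨ *-distribˡ-+ (+ (∣ A ∣ C m)) a _ ⟨
    + (∣ A ∣ C m) * (a + lin c A) ∎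
    where
    open ≡-Reasoning
    rearrange : ∀ p a q r → p + (a * q + r) ≡ q * a + (p + r)
    rearrange = solve-∀
    ∅-only : subsetSum (λ S → ind S 0 * lin c S) A ≡ 0ℤ
    ∅-only = subsetSum-zero (λ S → ind S 0 * lin c S) A λ S _ → trans (ind-cong S 0 (lin-∅ c S)) (*-zeroʳ (ind S 0))
    rest : ∀ m → + (pred ∣ A ∣ C m) * lin c A + subsetSum (λ S → ind S m * lin c S) A ≡ + (∣ A ∣ C m) * lin c A
    rest zero    = trans (cong₂ _+_ (cong (_* lin c A) (trans (+C0 (pred ∣ A ∣)) (sym (+C0 ∣ A ∣)))) ∅-only) (+-identityʳ _)
    rest (suc m) = trans (+-congˡ (+ (pred ∣ A ∣ C suc m) * lin c A) (subsetSum-ind-lin m c A))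
      (trans (sym (*-distribʳ-+ (lin c A) (+ (pred ∣ A ∣ C suc m)) (+ (pred ∣ A ∣ C m)))) (pascal ∣ A ∣ refl))
      where
      pascal : ∀ s → ∣ A ∣ ≡ s → (+ (pred s C suc m) + + (pred s C m)) * lin c A ≡ + (s C suc m) * lin c A
      pascal zero    e = trans (cong ((0ℤ + + (0 C m)) *_) (lin-∅ c A e)) (trans (*-zeroʳ (0ℤ + + (0 C m))) (sym (trans (cong (0ℤ *_) (lin-∅ c A e)) refl)))
      pascal (suc s) e = cong (_* lin c A) (trans (+-comm (+ (s C suc m)) (+ (s C m))) (+pascal s m))

  supersetSum-vanish : (x : Weight n) → ∀ S → (∀ A → ∣ S ∣ ℕ.≤ ∣ A ∣ → x A ≡ 0ℤ) → supersetSum x S ≡ 0ℤ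
  supersetSum-vanish x []          h = h [] ℕ.z≤n
  supersetSum-vanish x (false ∷ S) h = cong₂ _+_
    (supersetSum-vanish (x ∘ (false ∷_)) S (h ∘ (false ∷_)))
    (supersetSum-vanish (x ∘ (true ∷_)) S (λ A → h (true ∷ A) ∘ ℕₚ.m≤n⇒m≤1+n))
  supersetSum-vanish x (true ∷ S)  h = supersetSum-vanish (x ∘ (true ∷_)) S (λ A → h (true ∷ A) ∘ ℕ.s≤s)

  supersetSum-top : (x : Weight n) → ∀ S → (∀ A → ∣ S ∣ ℕ.< ∣ A ∣ → x A ≡ 0ℤ) → supersetSum x S ≡ x S
  supersetSum-top x []          h = refl
  supersetSum-top x (false ∷ S) h = trans (cong₂ _+_
    (supersetSum-top (x ∘ (false ∷_)) S (h ∘ (false ∷_)))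
    (supersetSum-vanish (x ∘ (true ∷_)) S (λ A → h (true ∷ A) ∘ ℕ.s≤s))) (+-identityʳ _)
  supersetSum-top x (true ∷ S)  h = supersetSum-top (x ∘ (true ∷_)) S (λ A → h (true ∷ A) ∘ ℕ.s≤s)

  supersetSum-level : ∀ {k} {x : Weight n} → Level k x → ∀ S → ∣ S ∣ ≡ k → supersetSum x S ≡ x S
  supersetSum-level {x = x} L S refl = supersetSum-top x S λ A lt → help A lt (L A)
    where
    help : ∀ A → ∣ S ∣ ℕ.< ∣ A ∣ → ∣ A ∣ ≡ ∣ S ∣ ⊎ x A ≡ 0ℤ → x A ≡ 0ℤ
    help A lt (inj₁ e) = contradiction (sym e) (ℕₚ.<⇒≢ lt)
    help A lt (inj₂ e) = e

  -- The up and down operators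

  -- Exchanging an element of S for one outside it contributes equally to `∂ (U x)` and `U (∂ x)`.
  -- Returning to S itself happens n - |S| times in the first and |S| times in the second.
  ∂U-commutator : (x : Weight n) → ∀ S → ∂ (U x) S + + 2 * + ∣ S ∣ * x S ≡ U (∂ x) S + + n * x S
  ∂U-commutator x [] = refl
  ∂U-commutator {suc n} x (false ∷ S) = begin
    ∂ (U x₀) S + (U x₁ S + x₀ S) + + 2 * + ∣ S ∣ * x₀ S
      ≡⟨ lhs (∂ (U x₀) S) (U x₁ S) (x₀ S) (+ 2 * + ∣ S ∣ * x₀ S) ⟩
    (∂ (U x₀) S + + 2 * + ∣ S ∣ * x₀ S) + (U x₁ S + x₀ S)
      ≡⟨ cong (_+ (U x₁ S + x₀ S)) (∂U-commutator x₀ S) ⟩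
    U (∂ x₀) S + + n * x₀ S + (U x₁ S + x₀ S)
      ≡⟨ rhs (U (∂ x₀) S) (U x₁ S) (+ n) (x₀ S) ⟩
    (U (∂ x₀) S + U x₁ S) + (1ℤ + + n) * x₀ S
      ≡⟨ cong (_+ + suc n * x₀ S) (U-+ (∂ x₀) x₁ S) ⟨
    U (λ A → ∂ x₀ A + x₁ A) S + + suc n * x₀ S ∎
    where
    open ≡-Reasoning
    x₀ = x ∘ (false ∷_)
    x₁ = x ∘ (true ∷_)
    lhs : ∀ a b c d → a + (b + c) + d ≡ (a + d) + (b + c)
    lhs = solve-∀
    rhs : ∀ a b n c → a + n * c + (b + c) ≡ (a + b) + (1ℤ + n) * c
    rhs = solve-∀
  ∂U-commutator {suc n} x (true ∷ S) = begin
    ∂ (λ A → U x₁ A + x₀ A) S + + 2 * (1ℤ + + ∣ S ∣) * x₁ S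
      ≡⟨ cong (_+ + 2 * (1ℤ + + ∣ S ∣) * x₁ S) (∂-+ (U x₁) x₀ S) ⟩
    ∂ (U x₁) S + ∂ x₀ S + + 2 * (1ℤ + + ∣ S ∣) * x₁ S
      ≡⟨ lhs (∂ (U x₁) S) (∂ x₀ S) (+ ∣ S ∣) (x₁ S) ⟩
    (∂ (U x₁) S + + 2 * + ∣ S ∣ * x₁ S) + (∂ x₀ S + + 2 * x₁ S)
      ≡⟨ cong (_+ (∂ x₀ S + + 2 * x₁ S)) (∂U-commutator x₁ S) ⟩
    U (∂ x₁) S + + n * x₁ S + (∂ x₀ S + + 2 * x₁ S)
      ≡⟨ rhs (U (∂ x₁) S) (∂ x₀ S) (+ n) (x₁ S) ⟩
    U (∂ x₁) S + (∂ x₀ S + x₁ S) + (1ℤ + + n) * x₁ S ∎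
    where
    open ≡-Reasoning
    x₀ = x ∘ (false ∷_)
    x₁ = x ∘ (true ∷_)
    lhs : ∀ a b s c → a + b + + 2 * (1ℤ + s) * c ≡ (a + + 2 * s * c) + (b + + 2 * c)
    lhs = solve-∀
    rhs : ∀ a b n c → a + n * c + (b + + 2 * c) ≡ a + (b + c) + (1ℤ + n) * c
    rhs = solve-∀

  -- `∂` counts a superset A of S once for each element of A outside S, that is |A| - |S| times.
  ∂-supersetSum : (x : Weight n) → ∀ S →
    ∂ (supersetSum x) S + + ∣ S ∣ * supersetSum x S ≡ supersetSum (λ A → + ∣ A ∣ * x A) S
  ∂-supersetSum x []          = refl
  ∂-supersetSum x (false ∷ S) = begin
    ∂ (λ A → z₀ A + z₁ A) S + z₁ S + + ∣ S ∣ * (z₀ S + z₁ S)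
      ≡⟨ cong (λ w → w + z₁ S + + ∣ S ∣ * (z₀ S + z₁ S)) (∂-+ z₀ z₁ S) ⟩
    ∂ z₀ S + ∂ z₁ S + z₁ S + + ∣ S ∣ * (z₀ S + z₁ S)
      ≡⟨ rearrange (∂ z₀ S) (∂ z₁ S) (z₀ S) (z₁ S) (+ ∣ S ∣) ⟩
    (∂ z₀ S + + ∣ S ∣ * z₀ S) + (z₁ S + (∂ z₁ S + + ∣ S ∣ * z₁ S))
      ≡⟨ cong₂ _+_ (∂-supersetSum x₀ S) (+-congˡ (z₁ S) (∂-supersetSum x₁ S)) ⟩
    supersetSum (λ A → + ∣ A ∣ * x₀ A) S + (z₁ S + supersetSum (λ A → + ∣ A ∣ * x₁ A) S)
      ≡⟨ +-congˡ (supersetSum (λ A → + ∣ A ∣ * x₀ A) S) (sym (succ x₁ S)) ⟩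
    supersetSum (λ A → + ∣ A ∣ * x₀ A) S + supersetSum (λ A → + suc ∣ A ∣ * x₁ A) S ∎
    where
    open ≡-Reasoning
    x₀ = x ∘ (false ∷_)
    x₁ = x ∘ (true ∷_)
    z₀ = supersetSum x₀
    z₁ = supersetSum x₁
    rearrange : ∀ a b c d s → a + b + d + s * (c + d) ≡ (a + s * c) + (d + (b + s * d))
    rearrange = solve-∀
    succ : ∀ {n} (x : Weight n) S → supersetSum (λ A → + suc ∣ A ∣ * x A) S ≡ supersetSum x S + supersetSum (λ A → + ∣ A ∣ * x A) S
    succ x S = trans (supersetSum-cong (λ A → suc-* (+ ∣ A ∣) (x A)) S) (supersetSum-+ x (λ A → + ∣ A ∣ * x A) S)
  ∂-supersetSum x (true ∷ S)  = begin
    ∂ z₁ S + (1ℤ + + ∣ S ∣) * z₁ S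
      ≡⟨ rearrange (∂ z₁ S) (z₁ S) (+ ∣ S ∣) ⟩
    z₁ S + (∂ z₁ S + + ∣ S ∣ * z₁ S)
      ≡⟨ +-congˡ (z₁ S) (∂-supersetSum x₁ S) ⟩
    z₁ S + supersetSum (λ A → + ∣ A ∣ * x₁ A) S
      ≡⟨ supersetSum-+ x₁ (λ A → + ∣ A ∣ * x₁ A) S ⟨
    supersetSum (λ A → x₁ A + + ∣ A ∣ * x₁ A) S
      ≡⟨ supersetSum-cong (λ A → suc-* (+ ∣ A ∣) (x₁ A)) S ⟨
    supersetSum (λ A → + suc ∣ A ∣ * x₁ A) S ∎
    where
    open ≡-Reasoning
    x₁ = x ∘ (true ∷_)
    z₁ = supersetSum x₁
    rearrange : ∀ b d s → b + (1ℤ + s) * d ≡ d + (b + s * d)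
    rearrange = solve-∀

  ∂-level : ∀ {k} {x : Weight n} → Level k x → ∀ S →
    ∂ (supersetSum x) S ≡ (+ k - + ∣ S ∣) * supersetSum x S
  ∂-level {k = k} {x} L S = begin
    ∂ z S                                          ≡⟨ add-sub (∂ z S) (+ ∣ S ∣ * z S) ⟩
    (∂ z S + + ∣ S ∣ * z S) - + ∣ S ∣ * z S        ≡⟨ cong (_- + ∣ S ∣ * z S) (∂-supersetSum x S) ⟩
    supersetSum (λ A → + ∣ A ∣ * x A) S - + ∣ S ∣ * z S
      ≡⟨ cong (_- + ∣ S ∣ * z S) (trans (supersetSum-cong (λ A → trans (*-comm (+ ∣ A ∣) (x A)) (trans (level-cong L A (cong λ m → + m)) (*-comm (x A) (+ k)))) S) (supersetSum-* (+ k) x S)) ⟩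
    + k * z S - + ∣ S ∣ * z S                      ≡⟨ factor (+ k) (+ ∣ S ∣) (z S) ⟩
    (+ k - + ∣ S ∣) * z S                          ∎
    where
    open ≡-Reasoning
    z = supersetSum x
    add-sub : ∀ a b → a ≡ (a + b) - b
    add-sub = solve-∀
    factor : ∀ k s z → k * z - s * z ≡ (k - s) * z
    factor = solve-∀

  ∂-ind : ∀ m (x : Weight n) S → ∂ (λ A → ind A (suc m) * x A) S ≡ ind S m * ∂ x S
  ∂-ind m       x []          = sym (*-zeroʳ (ind [] m))
  ∂-ind m       x (false ∷ S) = trans (cong (_+ ind S m * x (true ∷ S)) (∂-ind m (x ∘ (false ∷_)) S))
    (sym (*-distribˡ-+ (ind S m) _ _))
  ∂-ind (suc m) x (true ∷ S)  = ∂-ind m (x ∘ (true ∷_)) S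
  ∂-ind zero    x (true ∷ S)  = vanish (x ∘ (true ∷_)) S
    where
    vanish : ∀ {n} (x : Weight n) S → ∂ (λ A → ind A 0 * x A) S ≡ 0ℤ
    vanish x []          = refl
    vanish x (false ∷ S) = trans (+-identityʳ _) (vanish (x ∘ (false ∷_)) S)
    vanish {suc n} x (true ∷ S)  = zeros S
      where
      zeros : ∀ {n} (S : Subset n) → ∂ (λ _ → 0ℤ) S ≡ 0ℤ
      zeros []          = refl
      zeros (false ∷ S) = trans (+-identityʳ _) (zeros S)
      zeros (true ∷ S)  = zeros S
  -- Sums over one level

  ∑ₗ : ℕ → Weight n → ℤ
  ∑ₗ m x = ∑ (λ S → ind S m * x S)

  ∑ₗ-cong : ∀ m {x y : Weight n} → (∀ S → ∣ S ∣ ≡ m → x S ≡ y S) → ∑ₗ m x ≡ ∑ₗ m y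
  ∑ₗ-cong m h = ∑-cong λ S → ind-cong S m (h S)

  ∑ₗ-mono : ∀ m {x y : Weight n} → (∀ S → ∣ S ∣ ≡ m → x S ≤ y S) → ∑ₗ m x ≤ ∑ₗ m y
  ∑ₗ-mono m h = ∑-mono λ S → ind-mono S m (h S)

  ∑ₗ-zero : ∀ m {x : Weight n} → (∀ S → ∣ S ∣ ≡ m → x S ≡ 0ℤ) → ∑ₗ m x ≡ 0ℤ
  ∑ₗ-zero {n} m h = trans (∑ₗ-cong m h) (∑-zero {n} λ S → *-zeroʳ (ind S m))

  ∑ₗ-≥0 : ∀ m {x : Weight n} → (∀ S → ∣ S ∣ ≡ m → 0ℤ ≤ x S) → 0ℤ ≤ ∑ₗ m x
  ∑ₗ-≥0 {n} m h = ≤-trans (≤-reflexive (sym (∑ₗ-zero {n} m {λ _ → 0ℤ} λ _ _ → refl))) (∑ₗ-mono m h)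

  ∑ₗ-+ : ∀ m (x y : Weight n) → ∑ₗ m (λ S → x S + y S) ≡ ∑ₗ m x + ∑ₗ m y
  ∑ₗ-+ m x y = trans (∑-cong λ S → *-distribˡ-+ (ind S m) (x S) (y S)) (∑-+ (λ S → ind S m * x S) _)

  ∑ₗ-* : ∀ m a (x : Weight n) → ∑ₗ m (λ S → a * x S) ≡ a * ∑ₗ m x
  ∑ₗ-* m a x = trans (∑-cong λ S → swap (ind S m) a (x S)) (∑-* a (λ S → ind S m * x S))
    where
    swap : ∀ i a x → i * (a * x) ≡ a * (i * x)
    swap = solve-∀

  -- Norms on a level and their comparison between levels

  norm : ℕ → Weight n → ℤ
  norm m x = ∑ₗ m (λ S → x S * x S)

  norm-≥0 : ∀ m (x : Weight n) → 0ℤ ≤ norm m x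
  norm-≥0 m x = ∑ₗ-≥0 m λ S _ → 0≤i*i (x S)

  -- Cauchy-Schwarz without roots or division: each use supplies the `a` and `b` for which its own
  -- bounds are tight.
  ∑ₗ-square : ∀ m a b (x y : Weight n) →
    0ℤ ≤ a * a * norm m x + + 2 * a * b * ∑ₗ m (λ S → x S * y S) + b * b * norm m y
  ∑ₗ-square m a b x y = ≤-trans (norm-≥0 m (λ S → a * x S + b * y S)) (≤-reflexive (begin
    ∑ₗ m (λ S → (a * x S + b * y S) * (a * x S + b * y S))
      ≡⟨ ∑ₗ-cong m (λ S _ → expand a b (x S) (y S)) ⟩
    ∑ₗ m (λ S → a * a * (x S * x S) + + 2 * a * b * (x S * y S) + b * b * (y S * y S))
      ≡⟨ ∑ₗ-+ m (λ S → a * a * (x S * x S) + + 2 * a * b * (x S * y S)) (λ S → b * b * (y S * y S)) ⟩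
    ∑ₗ m (λ S → a * a * (x S * x S) + + 2 * a * b * (x S * y S)) + ∑ₗ m (λ S → b * b * (y S * y S))
      ≡⟨ cong₂ _+_ (trans (∑ₗ-+ m (λ S → a * a * (x S * x S)) (λ S → + 2 * a * b * (x S * y S)))
           (cong₂ _+_ (∑ₗ-* m (a * a) (λ S → x S * x S)) (∑ₗ-* m (+ 2 * a * b) (λ S → x S * y S)))) (∑ₗ-* m (b * b) (λ S → y S * y S)) ⟩
    a * a * norm m x + + 2 * a * b * ∑ₗ m (λ S → x S * y S) + b * b * norm m y ∎))
    where
    open ≡-Reasoning
    expand : ∀ a b x y → (a * x + b * y) * (a * x + b * y) ≡ a * a * (x * x) + + 2 * a * b * (x * y) + b * b * (y * y)
    expand = solve-∀

  ∂-adjointₗ : ∀ m (x y : Weight n) → ∑ₗ (suc m) (λ S → x S * U y S) ≡ ∑ₗ m (λ S → ∂ x S * y S)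
  ∂-adjointₗ m x y = begin
    ∑ (λ S → ind S (suc m) * (x S * U y S))   ≡⟨ ∑-cong (λ S → *-assoc (ind S (suc m)) (x S) (U y S)) ⟨
    ∑ (λ S → ind S (suc m) * x S * U y S)     ≡⟨ ∂-adjoint (λ S → ind S (suc m) * x S) y ⟩
    ∑ (λ S → ∂ (λ A → ind A (suc m) * x A) S * y S)
      ≡⟨ ∑-cong (λ S → trans (cong (_* y S) (∂-ind m x S)) (*-assoc (ind S m) _ _)) ⟩
    ∑ (λ S → ind S m * (∂ x S * y S))         ∎
    where open ≡-Reasoning

  -- Adjointness moves one `U` across as `∂`; the commutator replaces `∂ U` by `U ∂` plus the scalar
  -- n - 2(m+1); adjointness again turns the `U ∂` term into the squared norm of `∂ x`.
  norm-U : ∀ m (x : Weight n) →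
    norm (suc (suc m)) (U x) ≡ norm m (∂ x) + (+ n - + 2 * + suc m) * norm (suc m) x
  norm-U {n} m x = begin
    norm (suc (suc m)) (U x)                    ≡⟨ ∂-adjointₗ (suc m) (U x) x ⟩
    ∑ₗ (suc m) (λ S → ∂ (U x) S * x S)          ≡⟨ ∑ₗ-cong (suc m) commute ⟩
    ∑ₗ (suc m) (λ S → x S * U (∂ x) S + d * (x S * x S))
      ≡⟨ trans (∑ₗ-+ (suc m) (λ S → x S * U (∂ x) S) (λ S → d * (x S * x S))) (cong₂ _+_ (∂-adjointₗ m x (∂ x)) (∑ₗ-* (suc m) d (λ S → x S * x S))) ⟩
    norm m (∂ x) + d * norm (suc m) x           ∎
    where
    open ≡-Reasoning
    d = + n - + 2 * + suc m
    isolate : ∀ a s b c x → a + + 2 * s * x ≡ b + c * x → a * x ≡ x * b + (c - + 2 * s) * (x * x)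
    isolate a s b c x e = trans (add a s x) (trans (cong (λ w → (w - + 2 * s * x) * x) e) (sub b c s x))
      where
      add : ∀ a s x → a * x ≡ (a + + 2 * s * x - + 2 * s * x) * x
      add = solve-∀
      sub : ∀ b c s x → (b + c * x - + 2 * s * x) * x ≡ x * b + (c - + 2 * s) * (x * x)
      sub = solve-∀
    commute : ∀ S → ∣ S ∣ ≡ suc m → ∂ (U x) S * x S ≡ x S * U (∂ x) S + d * (x S * x S)
    commute S e = isolate (∂ (U x) S) (+ suc m) (U (∂ x) S) (+ n) (x S)
      (trans (cong (λ s → ∂ (U x) S + + 2 * + s * x S) (sym e)) (∂U-commutator x S))

  -- The instances of chain are the superset sums of the weights on level K.
  module Descent {n K : ℕ} (K+2≤n : K ℕ.+ 2 ℕ.≤ n) (x : Weight n)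
    (chain : ∀ S → ∂ x S ≡ (+ K - + ∣ S ∣) * x S) (norm₁ : norm 1 x ≡ 0ℤ) where

    ∑ₗ-∂ : ∀ m → ∑ₗ m (λ S → ∂ x S * x S) ≡ (+ K - + m) * norm m x
    ∑ₗ-∂ m = trans (∑ₗ-cong m λ S e → trans (cong (_* x S) (trans (chain S) (cong (λ s → (+ K - + s) * x S) e))) (*-assoc (+ K - + m) (x S) (x S)))
      (∑ₗ-* m (+ K - + m) (λ S → x S * x S))

    norm-∂ : ∀ m → norm m (∂ x) ≡ (+ K - + m) * (+ K - + m) * norm m x
    norm-∂ m = trans (∑ₗ-cong m λ S e → trans (cong₂ _*_ (at S e) (at S e)) (square (+ K - + m) (x S)))
      (∑ₗ-* m ((+ K - + m) * (+ K - + m)) (λ S → x S * x S))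
      where
      at : ∀ S → ∣ S ∣ ≡ m → ∂ x S ≡ (+ K - + m) * x S
      at S e = trans (chain S) (cong (λ s → (+ K - + s) * x S) e)
      square : ∀ d x → d * x * (d * x) ≡ d * d * (x * x)
      square = solve-∀

    -- ν m is the third largest eigenvalue of U ∂ on level m + 1; the two larger ones belong to the functions induced
    -- from levels 0 and 1, to which x is orthogonal by norm₁.
    ν : ℕ → ℤ
    ν m = (+ m - 1ℤ) * (+ n - + m - + 2)

    -- Let M be the level `suc m`. By adjointness (K - M) `norm M x` is the inner product of `x` and
    -- `U x` on level M + 1. The previous step, fed into `norm-U`, bounds the squared norm of `U x`
    -- there by `ν M * norm M x`, and Cauchy-Schwarz finishes.
    norm-step : ∀ m → suc m ℕ.< K →
      (+ K - + suc m) * (+ K - + suc m) * norm (suc m) x ≤ ν (suc m) * norm (suc (suc m)) x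
    -- Here `ν 1` is 0, so nothing short of `norm 1 x ≡ 0ℤ` would do: this is where the vanishing
    -- degrees enter.
    norm-step zero    lt = ≤-reflexive (trans (cong ((+ K - 1ℤ) * (+ K - 1ℤ) *_) norm₁) (*-zeroʳ ((+ K - 1ℤ) * (+ K - 1ℤ))))
    norm-step (suc m) lt = *-cancelˡ-≤-pos _ _ (ν M) {{ν-pos}} (0≤i-j⇒j≤i (begin
      0ℤ
        -- With the coefficients `ν M` and `- d` the square vanishes in the extremal case, where the
        -- bound on `U x` and the claim are equalities.
        ≤⟨ ∑ₗ-square (suc M) (ν M) (- d) x (U x) ⟩
      ν M * ν M * N₊ + + 2 * ν M * (- d) * ∑ₗ (suc M) (λ S → x S * U x S) + (- d) * (- d) * norm (suc M) (U x)
        ≡⟨ cong₂ (λ p q → ν M * ν M * N₊ + + 2 * ν M * (- d) * p + (- d) * (- d) * q) (trans (∂-adjointₗ M x x) (∑ₗ-∂ M)) (norm-U (suc m) x) ⟩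
      ν M * ν M * N₊ + + 2 * ν M * (- d) * (d * N) + (- d) * (- d) * (norm (suc m) (∂ x) + e * N)
        ≤⟨ +-monoʳ-≤ (ν M * ν M * N₊ + + 2 * ν M * (- d) * (d * N)) (*-monoˡ-≤-nonNeg ((- d) * (- d)) {{nonNegative (0≤i*i (- d))}} bound) ⟩
      ν M * ν M * N₊ + + 2 * ν M * (- d) * (d * N) + (- d) * (- d) * (ν M * N)
        ≡⟨ collect (ν M) d N N₊ ⟩
      ν M * (ν M * N₊) - ν M * (d * d * N) ∎))
      where
      open ≤-Reasoning
      M  = suc (suc m)
      N  = norm M x
      N₊ = norm (suc M) x
      d  = + K - + M
      e  = + n - + 2 * + M
      -- Together with the value 0 at level 1 this recurrence determines `ν`; the increment is the
      -- scalar of the commutator.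
      recurrence : ∀ s n → (s - 1ℤ) * (n - s - + 2) + (n - + 2 * (1ℤ + s)) ≡ (1ℤ + s - 1ℤ) * (n - (1ℤ + s) - + 2)
      recurrence = solve-∀
      collect : ∀ v d a b → v * v * b + + 2 * v * (- d) * (d * a) + (- d) * (- d) * (v * a) ≡ v * (v * b) - v * (d * d * a)
      collect = solve-∀
      bound : norm (suc m) (∂ x) + e * N ≤ ν M * N
      bound = ≤-trans (+-monoˡ-≤ (e * N) (≤-trans (≤-reflexive (norm-∂ (suc m))) (norm-step m (ℕₚ.<-trans (ℕₚ.n<1+n (suc m)) lt))))
        (≤-reflexive (trans (sym (*-distribʳ-+ N (ν (suc m)) e)) (cong (_* N) (recurrence (+ suc m) (+ n)))))
      gap : 0ℤ < + n - + M - + 2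
      gap = subst (0ℤ <_) (assoc (+ n) (+ M)) (subst (_< + n - + (M ℕ.+ 2)) (+-inverseʳ (+ (M ℕ.+ 2)))
        (+-monoˡ-< (- (+ (M ℕ.+ 2))) (+<+ (ℕₚ.<-≤-trans (ℕₚ.+-monoˡ-< 2 lt) K+2≤n))))
        where
        assoc : ∀ a b → a - (b + + 2) ≡ a - b - + 2
        assoc = solve-∀
      ν-pos : Positive (ν M)
      ν-pos = positive (subst (_< ν M) (*-zeroʳ (+ M - 1ℤ)) (*-monoˡ-<-pos (+ M - 1ℤ) gap))

    -- Multiplying `norm-step` over the levels m + 1 to K - 1 gives the factor C(K-2, m-1) C(n-m-3,
    -- j). Multiplying by K(K-1) trades C(K-2, m-1) for (m+1) m C(K, m+1), which also makes sense
    -- for m = 0.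
    norm-bound : ∀ j m q → suc m ℕ.+ j ≡ K → suc m ℕ.+ 2 ℕ.+ q ≡ n →
      + K * (+ K - 1ℤ) * norm (suc m) x ≤ + suc m * (+ suc m - 1ℤ) * + (K C suc m) * + (q C j) * norm K x
    norm-bound zero    m q e f = ≤-reflexive (trans (cong (λ s → + K * (+ K - 1ℤ) * norm s x) s≡K) (cong (_* norm K x) (sym (begin
      + suc m * (+ suc m - 1ℤ) * + (K C suc m) * + (q C 0)
        ≡⟨ cong₂ (λ s w → + s * (+ s - 1ℤ) * + (K C s) * w) s≡K (+C0 q) ⟩
      + K * (+ K - 1ℤ) * + (K C K) * 1ℤ
        ≡⟨ cong (λ w → + K * (+ K - 1ℤ) * + w * 1ℤ) (nCn≡1 K) ⟩
      + K * (+ K - 1ℤ) * 1ℤ * 1ℤ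
        ≡⟨ trans (*-identityʳ _) (*-identityʳ _) ⟩
      + K * (+ K - 1ℤ) ∎))))
      where
      open ≡-Reasoning
      s≡K : suc m ≡ K
      s≡K = trans (sym (ℕₚ.+-identityʳ (suc m))) e
    norm-bound (suc j) m q e f with ℕₚ.m≤n⇒∃[o]m+o≡n (ℕₚ.+-cancelˡ-≤ (suc m ℕ.+ 2) (suc j) q (subst₂ ℕ._≤_ (trans (cong (ℕ._+ 2) (sym e)) (comm (suc m) (suc j))) (sym f) K+2≤n))
      where
      comm : ∀ a b → a ℕ.+ b ℕ.+ 2 ≡ a ℕ.+ 2 ℕ.+ b
      comm = ℕ-solve-∀
    -- Here r = n - K - 2, and the cancelled square is the factor (K - (m+1))² of one `norm-step`.
    ... | (r , refl) = *-cancelˡ-≤-pos _ _ (+ suc j * + suc j) (begin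
      + suc j * + suc j * (k₂ * norm M x)
        ≡⟨ swap (+ suc j * + suc j) k₂ (norm M x) ⟩
      k₂ * (+ suc j * + suc j * norm M x)
        ≤⟨ *-monoˡ-≤-nonNeg k₂ {{k₂-nonNeg}} (subst₂ (λ d v → d * d * norm M x ≤ v * norm (suc M) x) d≡ ν≡ (norm-step m (subst (M ℕ.<_) e (ℕₚ.m<m+n M (ℕ.s≤s ℕ.z≤n))))) ⟩
      k₂ * (+ m * + suc Q * norm (suc M) x)
        ≡⟨ swap k₂ (+ m * + suc Q) (norm (suc M) x) ⟩
      + m * + suc Q * (k₂ * norm (suc M) x)
        ≤⟨ *-monoˡ-≤-nonNeg (+ m * + suc Q) {{mq-nonNeg}} (norm-bound j M Q (trans (sym (ℕₚ.+-suc M j)) e) (trans (sym (ℕₚ.+-suc (M ℕ.+ 2) Q)) f)) ⟩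
      + m * + suc Q * (+ suc M * (+ suc M - 1ℤ) * + (K C suc M) * + (Q C j) * norm K x)
        ≡⟨ regroup (+ m) (+ suc Q) (+ suc M) (+ (K C suc M)) (+ (Q C j)) (norm K x) ⟩
      + m * (+ suc M - 1ℤ) * (+ suc M * + (K C suc M)) * (+ suc Q * + (Q C j)) * norm K x
        ≡⟨ cong₂ (λ a b → + m * (+ suc M - 1ℤ) * a * b * norm K x) shift absorb ⟩
      + m * (+ suc M - 1ℤ) * (+ suc j * + (K C M)) * (+ suc j * + (suc Q C suc j)) * norm K x
        ≡⟨ finish (+ m) (+ suc j) (+ (K C M)) (+ (suc Q C suc j)) (norm K x) ⟩
      + suc j * + suc j * (+ M * (+ M - 1ℤ) * + (K C M) * + (suc Q C suc j) * norm K x) ∎)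
      where
      open ≤-Reasoning
      M  = suc m
      Q  = j ℕ.+ r
      k₂ = + K * (+ K - 1ℤ)
      K≡ : K ≡ suc (M ℕ.+ j)
      K≡ = trans (sym e) (ℕₚ.+-suc M j)
      k₂-nonNeg : NonNegative k₂
      k₂-nonNeg = subst (λ k → NonNegative (+ k * (+ k - 1ℤ))) (sym K≡) (subst NonNegative (pos-* (suc (M ℕ.+ j)) (M ℕ.+ j)) _)
      mq-nonNeg : NonNegative (+ m * + suc Q)
      mq-nonNeg = subst NonNegative (pos-* m (suc Q)) _
      cancel : ∀ a b → a + b - a ≡ b
      cancel = solve-∀
      cancel₂ : ∀ a b → a + + 2 + b - a - + 2 ≡ b
      cancel₂ = solve-∀
      d≡ : + K - + M ≡ + suc j
      d≡ = trans (cong (λ k → + k - + M) (sym e)) (cancel (+ M) (+ suc j))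
      ν≡ : ν M ≡ + m * + suc Q
      ν≡ = trans (cong (λ k → (+ M - 1ℤ) * (+ k - + M - + 2)) (sym f)) (cong ((+ M - 1ℤ) *_) (cancel₂ (+ M) (+ suc Q)))
      shift : + suc M * + (K C suc M) ≡ + suc j * + (K C M)
      shift = trans (sym (pos-* (suc M) (K C suc M))) (trans (cong (λ c → + c)
        (subst (λ k → suc M ℕ.* (k C suc M) ≡ suc j ℕ.* (k C M)) (sym K≡) (C-shift M j))) (pos-* (suc j) (K C M)))
      absorb : + suc Q * + (Q C j) ≡ + suc j * + (suc Q C suc j)
      absorb = trans (sym (pos-* (suc Q) (Q C j))) (trans (cong (λ c → + c) (C-absorb j r)) (pos-* (suc j) (suc Q C suc j)))
      swap : ∀ a b c → a * (b * c) ≡ b * (a * c)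
      swap = solve-∀
      regroup : ∀ m q s c b w → m * q * (s * (s - 1ℤ) * c * b * w) ≡ m * (s - 1ℤ) * (s * c) * (q * b) * w
      regroup = solve-∀
      finish : ∀ m j c b w → m * (1ℤ + (1ℤ + m) - 1ℤ) * (j * c) * (j * b) * w ≡ j * j * ((1ℤ + m) * (1ℤ + m - 1ℤ) * c * b * w)
      finish = solve-∀

  -- The form `T`, balanced weights, and the bound for `T` on them

  ⟪_,_⟫ : Weight n → Weight n → ℤ
  ⟪ x , y ⟫ = ∑ (λ S → x S * y S)

  -- By `subsetSum-∁` this is the superset sum of `x ∘ ∁`, a weight on level n - k when `x` is on
  -- level k, so both factors of `T` are open to the same estimates.
  disjointSum : Weight n → Weight n
  disjointSum x S = subsetSum x (∁ S)

  -- T m x y = Σ x(A) y(B) C(|A \ B|, m).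
  T : ℕ → Weight n → Weight n → ℤ
  T m x y = ∑ₗ m (λ S → supersetSum x S * disjointSum y S)

  ∑ₗ-level : ∀ {k} {x : Weight n} → Level k x → ∀ y → ∑ₗ k (λ S → x S * y S) ≡ ⟪ x , y ⟫
  ∑ₗ-level {k = k} {x} L y = ∑-cong λ S → trans (swap (ind S k) (x S) (y S))
    (trans (level-cong L S (λ e → cong (_* y S) (subst (λ s → ind S s ≡ 1ℤ) e (ind-≡1 S)))) (cong (x S *_) (*-identityˡ (y S))))
    where
    swap : ∀ i x y → i * (x * y) ≡ x * (i * y)
    swap = solve-∀

  norm-supersetSum : ∀ {k} {x : Weight n} → Level k x → norm k (supersetSum x) ≡ ⟪ x , x ⟫
  norm-supersetSum {k = k} {x} L = trans
    (∑ₗ-cong k λ S e → cong₂ _*_ (supersetSum-level L S e) (supersetSum-level L S e)) (∑ₗ-level L x)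

  supersetSum-∅ : (x : Weight n) → ∀ S → ∣ S ∣ ≡ 0 → supersetSum x S ≡ ∑ x
  supersetSum-∅ x []          e = refl
  supersetSum-∅ x (false ∷ S) e = cong₂ _+_ (supersetSum-∅ (x ∘ (false ∷_)) S e) (supersetSum-∅ (x ∘ (true ∷_)) S e)

  degrees : Weight n → Vec ℤ n
  degrees {zero}  x = []
  degrees {suc n} x = ∑ (x ∘ (true ∷_)) ∷ degrees (λ A → x (false ∷ A) + x (true ∷ A))

  lin-degrees : (x : Weight n) → ∀ S → ∣ S ∣ ≡ 1 → lin (degrees x) S ≡ supersetSum x S
  lin-degrees x (false ∷ S) e = trans (lin-degrees (λ A → x (false ∷ A) + x (true ∷ A)) S e)
    (supersetSum-+ (x ∘ (false ∷_)) (x ∘ (true ∷_)) S)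
  lin-degrees x (true ∷ S)  e = begin
    ∑ (x ∘ (true ∷_)) + lin (degrees (λ A → x (false ∷ A) + x (true ∷ A))) S
      ≡⟨ +-congˡ (∑ (x ∘ (true ∷_))) (lin-∅ (degrees (λ A → x (false ∷ A) + x (true ∷ A))) S (ℕₚ.suc-injective e)) ⟩
    ∑ (x ∘ (true ∷_)) + 0ℤ            ≡⟨ +-identityʳ _ ⟩
    ∑ (x ∘ (true ∷_))                 ≡⟨ supersetSum-∅ (x ∘ (true ∷_)) S (ℕₚ.suc-injective e) ⟨
    supersetSum (x ∘ (true ∷_)) S     ∎
    where open ≡-Reasoning

  -- Double counting of the pairs of a set and one of its elements.
  lin-degrees-⊤ : (x : Weight n) → lin (degrees x) ⊤ ≡ ∑ (λ A → x A * + ∣ A ∣)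
  lin-degrees-⊤ {zero}  x = sym (*-zeroʳ (x []))
  lin-degrees-⊤ {suc n} x = begin
    ∑ x₁ + lin (degrees (λ A → x₀ A + x₁ A)) ⊤
      ≡⟨ +-congˡ (∑ x₁) (trans (lin-degrees-⊤ (λ A → x₀ A + x₁ A)) (trans (∑-cong λ A → *-distribʳ-+ (+ ∣ A ∣) (x₀ A) (x₁ A)) (∑-+ (λ A → x₀ A * + ∣ A ∣) (λ A → x₁ A * + ∣ A ∣)))) ⟩
    ∑ x₁ + (∑ (λ A → x₀ A * + ∣ A ∣) + ∑ (λ A → x₁ A * + ∣ A ∣))
      ≡⟨ swap (∑ x₁) (∑ (λ A → x₀ A * + ∣ A ∣)) _ ⟩
    ∑ (λ A → x₀ A * + ∣ A ∣) + (∑ x₁ + ∑ (λ A → x₁ A * + ∣ A ∣))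
      ≡⟨ +-congˡ (∑ (λ A → x₀ A * + ∣ A ∣)) (∑-+ x₁ (λ A → x₁ A * + ∣ A ∣)) ⟨
    ∑ (λ A → x₀ A * + ∣ A ∣) + ∑ (λ A → x₁ A + x₁ A * + ∣ A ∣)
      ≡⟨ +-congˡ (∑ (λ A → x₀ A * + ∣ A ∣)) (∑-cong (λ A → sym (*-suc (x₁ A) (+ ∣ A ∣)))) ⟩
    ∑ (λ A → x₀ A * + ∣ A ∣) + ∑ (λ A → x₁ A * + suc ∣ A ∣) ∎
    where
    open ≡-Reasoning
    x₀ = x ∘ (false ∷_)
    x₁ = x ∘ (true ∷_)
    swap : ∀ a b c → a + (b + c) ≡ b + (a + c)
    swap = solve-∀

  lin-affine : ∀ p r (c : Vec ℤ n) S → lin (Vec.map (λ d → p * d - r) c) S ≡ p * lin c S - r * + ∣ S ∣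
  lin-affine p r []      []          = base p r
    where
    base : ∀ p r → 0ℤ ≡ p * 0ℤ - r * 0ℤ
    base = solve-∀
  lin-affine p r (d ∷ c) (false ∷ S) = lin-affine p r c S
  lin-affine p r (d ∷ c) (true ∷ S)  = trans (+-congˡ (p * d - r) (lin-affine p r c S)) (step p r d (lin c S) (+ ∣ S ∣))
    where
    step : ∀ p r d l s → p * d - r + (p * l - r * s) ≡ p * (d + l) - r * (1ℤ + s)
    step = solve-∀

  -- Transposing `supersetSum` leaves only counts of subsets of a k-set. On a level, the superset
  -- sums and the disjoint sums of a star are affine in `lin c S`, so this evaluates `T` with a star
  -- on either side.
  ∑ₗ-supersetSum-affine : ∀ {k} {x : Weight n} → Level k x → ∀ m α β c →
    ∑ₗ (suc m) (λ S → supersetSum x S * (α + β * lin c S))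
      ≡ α * + (k C suc m) * ∑ x + β * + (pred k C m) * ⟪ x , lin c ⟫
  ∑ₗ-supersetSum-affine {k = k} {x} L m α β c = begin
    ∑ (λ S → ind S (suc m) * (supersetSum x S * (α + β * lin c S)))
      ≡⟨ ∑-cong (λ S → expand (ind S (suc m)) (supersetSum x S) α β (lin c S)) ⟩
    ∑ (λ S → supersetSum x S * (α * ind S (suc m) + β * (ind S (suc m) * lin c S)))
      ≡⟨ supersetSum-adjoint x _ ⟩
    ∑ (λ A → x A * subsetSum (λ S → α * ind S (suc m) + β * (ind S (suc m) * lin c S)) A)
      ≡⟨ ∑-cong (λ A → trans (cong (x A *_) (affine A)) (level-cong L A (cong λ s → α * + (s C suc m) + β * (+ (pred s C m) * lin c A)))) ⟩
    ∑ (λ A → x A * (α * + (k C suc m) + β * (+ (pred k C m) * lin c A)))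
      ≡⟨ ∑-cong (λ A → regroup (x A) α (+ (k C suc m)) β (+ (pred k C m)) (lin c A)) ⟩
    ∑ (λ A → α * + (k C suc m) * x A + β * + (pred k C m) * (x A * lin c A))
      ≡⟨ trans (∑-+ (λ A → α * + (k C suc m) * x A) (λ A → β * + (pred k C m) * (x A * lin c A)))
           (cong₂ _+_ (∑-* (α * + (k C suc m)) x) (∑-* (β * + (pred k C m)) (λ A → x A * lin c A))) ⟩
    α * + (k C suc m) * ∑ x + β * + (pred k C m) * ⟪ x , lin c ⟫ ∎
    where
    open ≡-Reasoning
    expand : ∀ i z α β l → i * (z * (α + β * l)) ≡ z * (α * i + β * (i * l))
    expand = solve-∀
    regroup : ∀ x α p β q l → x * (α * p + β * (q * l)) ≡ α * p * x + β * q * (x * l)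
    regroup = solve-∀
    affine : ∀ A → subsetSum (λ S → α * ind S (suc m) + β * (ind S (suc m) * lin c S)) A
      ≡ α * + (∣ A ∣ C suc m) + β * (+ (pred ∣ A ∣ C m) * lin c A)
    affine A = trans (subsetSum-+ (λ S → α * ind S (suc m)) (λ S → β * (ind S (suc m) * lin c S)) A) (cong₂ _+_
      (trans (subsetSum-* α (λ S → ind S (suc m)) A) (cong (α *_) (subsetSum-ind (suc m) A)))
      (trans (subsetSum-* β (λ S → ind S (suc m) * lin c S) A) (cong (β *_) (subsetSum-ind-lin m c A))))

  lin-of-∁ : ∀ (c : Vec ℤ n) S → lin c (∁ S) ≡ lin c ⊤ + - 1ℤ * lin c S
  lin-of-∁ c S = trans (sub (lin c (∁ S)) (lin c S)) (cong (_+ - 1ℤ * lin c S) (lin-∁ c S))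
    where
    sub : ∀ a b → a ≡ b + a + - 1ℤ * b
    sub = solve-∀

  -- Balanced weights are those orthogonal to every lin c.
  Balanced : Weight n → Set
  Balanced x = ∀ S → ∣ S ∣ ≡ 1 → supersetSum x S ≡ 0ℤ

  balanced-lin : {x : Weight n} → Balanced x → ∀ c → ⟪ x , lin c ⟫ ≡ 0ℤ
  balanced-lin {x = x} bal c = begin
    ∑ (λ A → x A * lin c A)
      ≡⟨ ∑-cong (λ A → cong (x A *_) (trans (subsetSum-ind-lin 0 c A) (trans (cong (_* lin c A) (+C0 (pred ∣ A ∣))) (*-identityˡ _)))) ⟨
    ∑ (λ A → x A * subsetSum (λ S → ind S 1 * lin c S) A)
      ≡⟨ supersetSum-adjoint x _ ⟨
    ∑ (λ S → supersetSum x S * (ind S 1 * lin c S))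
      ≡⟨ ∑-cong (λ S → swap (supersetSum x S) (ind S 1) (lin c S)) ⟩
    ∑ₗ 1 (λ S → supersetSum x S * lin c S)
      ≡⟨ ∑ₗ-zero 1 (λ S e → trans (cong (_* lin c S) (bal S e)) (*-zeroˡ (lin c S))) ⟩
    0ℤ ∎
    where
    open ≡-Reasoning
    swap : ∀ a b c → a * (b * c) ≡ b * (a * c)
    swap = solve-∀

  -- The degrees of a weight on level `suc k` add up to `suc k` times its total.
  balanced-∑ : ∀ {k} {x : Weight n} → Level (suc k) x → Balanced x → ∑ x ≡ 0ℤ
  balanced-∑ {n} {k} {x} L bal = *-cancelˡ-≡ (+ suc k) _ _ (begin
    + suc k * ∑ x
      ≡⟨ ∑-* (+ suc k) x ⟨
    ∑ (λ A → + suc k * x A)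
      ≡⟨ ∑-cong (λ A → trans (*-comm (+ suc k) (x A)) (sym (level-cong L A λ e → sym (cong (λ s → + s) (sym e))))) ⟩
    ∑ (λ A → x A * + ∣ A ∣)
      ≡⟨ ∑-cong (λ A → cong (x A *_) (trans (subsetSum-ind 1 A) (cong (λ s → + s) (nC1≡n ∣ A ∣)))) ⟨
    ∑ (λ A → x A * subsetSum (λ S → ind S 1) A)
      ≡⟨ supersetSum-adjoint x (λ S → ind S 1) ⟨
    ∑ (λ S → supersetSum x S * ind S 1)
      ≡⟨ ∑-cong (λ S → *-comm (supersetSum x S) (ind S 1)) ⟩
    ∑ₗ 1 (supersetSum x)
      ≡⟨ ∑ₗ-zero 1 bal ⟩
    0ℤ
      ≡⟨ *-zeroʳ (+ suc k) ⟨
    + suc k * 0ℤ ∎)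
    where open ≡-Reasoning

  -- The degree of an element in `x ∘ ∁` is the weight under `x` of the sets that avoid it.
  balanced-∁ : {x : Weight n} → ∑ x ≡ 0ℤ → Balanced x → Balanced (x ∘ ∁)
  balanced-∁ {x = x} s bal S e = begin
    supersetSum (x ∘ ∁) S     ≡⟨ split x S e ⟩
    ∑ x - supersetSum x S     ≡⟨ cong₂ _-_ s (bal S e) ⟩
    0ℤ                        ∎
    where
    open ≡-Reasoning
    split : ∀ {n} (x : Weight n) S → ∣ S ∣ ≡ 1 → supersetSum (x ∘ ∁) S ≡ ∑ x - supersetSum x S
    split {suc n} x (false ∷ S) e = trans (cong₂ _+_ (split (x ∘ (true ∷_)) S e) (split (x ∘ (false ∷_)) S e))
      (arrange (∑ (x ∘ (true ∷_))) (supersetSum (x ∘ (true ∷_)) S) (∑ (x ∘ (false ∷_))) (supersetSum (x ∘ (false ∷_)) S))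
      where
      arrange : ∀ a b c d → a - b + (c - d) ≡ c + a - (d + b)
      arrange = solve-∀
    split {suc n} x (true ∷ S)  e = begin
      supersetSum (x ∘ (false ∷_) ∘ ∁) S      ≡⟨ supersetSum-∅ _ S (ℕₚ.suc-injective e) ⟩
      ∑ (x ∘ (false ∷_) ∘ ∁)                  ≡⟨ ∑-∁ (x ∘ (false ∷_)) ⟩
      ∑ (x ∘ (false ∷_))                      ≡⟨ add-sub (∑ (x ∘ (false ∷_))) (∑ (x ∘ (true ∷_))) ⟩
      ∑ (x ∘ (false ∷_)) + ∑ (x ∘ (true ∷_)) - ∑ (x ∘ (true ∷_))
        ≡⟨ cong (λ w → ∑ x - w) (supersetSum-∅ (x ∘ (true ∷_)) S (ℕₚ.suc-injective e)) ⟨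
      ∑ x - supersetSum (x ∘ (true ∷_)) S     ∎
      where
      add-sub : ∀ a b → a ≡ a + b - b
      add-sub = solve-∀

  -- `Nz` and `Nw` are squared norms of two functions and `t` is their inner product. Cauchy-Schwarz
  -- gives κ κ' t² ≤ M² Ck Ck' X Y N², and the exchange identity turns this into (κ t)² ≤ (M Ck Y
  -- N)². The same identity makes the coefficients `Y` and `s * X` balance the two square terms; the
  -- sign `s` yields both directions.
  am-gm : ∀ X Y {{_ : Positive X}} {{_ : Positive Y}} M Ck Ck' κ κ' {{_ : NonNegative κ}} {{_ : Positive κ'}} N Nz Nw t s →
    s * s ≡ 1ℤ → κ * Nz ≤ M * Ck * X * N → κ' * Nw ≤ M * Ck' * Y * N → κ * Ck' * X ≡ κ' * Ck * Y →
    0ℤ ≤ Y * Y * Nz + + 2 * Y * (s * X) * t + (s * X) * (s * X) * Nw →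
    0ℤ ≤ M * Ck * Y * N + s * (κ * t)
  am-gm X@(+[1+ _ ]) Y@(+[1+ _ ]) M Ck Ck' κ@(+ _) κ'@(+[1+ _ ]) N Nz Nw t s s² z≤ w≤ swap sq =
    *-cancelˡ-≤-pos 0ℤ _ (+ 2 * (X * Y * κ')) (begin
    + 2 * (X * Y * κ') * 0ℤ
      ≡⟨ trans (*-zeroʳ (+ 2 * (X * Y * κ'))) (sym (*-zeroʳ (κ * κ'))) ⟩
    κ * κ' * 0ℤ
      ≤⟨ *-monoˡ-≤-nonNeg (κ * κ') {{nonNeg-* κ κ'}} sq ⟩
    κ * κ' * (Y * Y * Nz + + 2 * Y * (s * X) * t + (s * X) * (s * X) * Nw)
      ≡⟨ expand κ κ' X Y Nz Nw t s ⟩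
    κ' * (Y * Y) * (κ * Nz) + + 2 * κ * κ' * X * Y * s * t + s * s * (κ * (X * X) * (κ' * Nw))
      ≡⟨ cong (λ w → κ' * (Y * Y) * (κ * Nz) + + 2 * κ * κ' * X * Y * s * t + w) (trans (cong (_* (κ * (X * X) * (κ' * Nw))) s²) (*-identityˡ _)) ⟩
    κ' * (Y * Y) * (κ * Nz) + + 2 * κ * κ' * X * Y * s * t + κ * (X * X) * (κ' * Nw)
      ≤⟨ +-mono-≤ (+-monoˡ-≤ (+ 2 * κ * κ' * X * Y * s * t) (*-monoˡ-≤-nonNeg (κ' * (Y * Y)) {{nonNeg-* κ' (Y * Y) {{_}} {{nonNeg-* Y Y}}}} z≤))
           (*-monoˡ-≤-nonNeg (κ * (X * X)) {{nonNeg-* κ (X * X) {{_}} {{nonNeg-* X X}}}} w≤) ⟩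
    κ' * (Y * Y) * (M * Ck * X * N) + + 2 * κ * κ' * X * Y * s * t + κ * (X * X) * (M * Ck' * Y * N)
      ≡⟨ regroup κ κ' X Y M Ck Ck' N t s ⟩
    κ' * (Y * Y) * (M * Ck * X * N) + + 2 * κ * κ' * X * Y * s * t + X * Y * M * N * (κ * Ck' * X)
      ≡⟨ cong (λ w → κ' * (Y * Y) * (M * Ck * X * N) + + 2 * κ * κ' * X * Y * s * t + X * Y * M * N * w) swap ⟩
    κ' * (Y * Y) * (M * Ck * X * N) + + 2 * κ * κ' * X * Y * s * t + X * Y * M * N * (κ' * Ck * Y)
      ≡⟨ collect κ κ' X Y M Ck N t s ⟩
    + 2 * (X * Y * κ') * (M * Ck * Y * N + s * (κ * t)) ∎)
    where
    open ≤-Reasoning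
    nonNeg-* : ∀ x y {{_ : NonNegative x}} {{_ : NonNegative y}} → NonNegative (x * y)
    nonNeg-* (+ x) (+ y) = subst NonNegative (pos-* x y) _
    expand : ∀ κ κ' X Y Nz Nw t s → κ * κ' * (Y * Y * Nz + + 2 * Y * (s * X) * t + (s * X) * (s * X) * Nw)
      ≡ κ' * (Y * Y) * (κ * Nz) + + 2 * κ * κ' * X * Y * s * t + s * s * (κ * (X * X) * (κ' * Nw))
    expand = solve-∀
    regroup : ∀ κ κ' X Y M Ck Ck' N t s → κ' * (Y * Y) * (M * Ck * X * N) + + 2 * κ * κ' * X * Y * s * t + κ * (X * X) * (M * Ck' * Y * N)
      ≡ κ' * (Y * Y) * (M * Ck * X * N) + + 2 * κ * κ' * X * Y * s * t + X * Y * M * N * (κ * Ck' * X)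
    regroup = solve-∀
    collect : ∀ κ κ' X Y M Ck N t s → κ' * (Y * Y) * (M * Ck * X * N) + + 2 * κ * κ' * X * Y * s * t + X * Y * M * N * (κ' * Ck * Y)
      ≡ + 2 * (X * Y * κ') * (M * Ck * Y * N + s * (κ * t))
    collect = solve-∀

  module _ {n a b : ℕ} (n≡ : suc (suc a) ℕ.+ suc (suc b) ≡ n) where

    private
      k  = suc (suc a)
      k' = suc (suc b)

    -- The two factors of `T` are the superset sums of `x` and of `x ∘ ∁`, bounded by descents from
    -- level k and from level n - k. The result is rescaled from C(n-t-2, k-2) to C(n-t-1, k-1),
    -- with t = m + 1, because the latter is the coefficient that stars produce.
    T-bound : {x : Weight n} → Level k x → Balanced x → ∀ m j j' q →
      suc m ℕ.+ j ≡ k → suc m ℕ.+ j' ≡ k' → suc m ℕ.+ 2 ℕ.+ q ≡ n → ∀ s → s * s ≡ 1ℤ →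
      0ℤ ≤ + suc m * + m * + (k C suc m) * + (suc q C suc a) * ⟪ x , x ⟫ + s * (+ k * + suc q * T (suc m) x x)
    T-bound {x} L bal m j j' q k≡ k'≡ q≡ s s² = *-cancelˡ-≤-pos 0ℤ _ (+ suc a) (begin
      + suc a * 0ℤ
        ≡⟨ trans (*-zeroʳ (+ suc a)) (sym (*-zeroʳ (+ suc q))) ⟩
      + suc q * 0ℤ
        ≤⟨ *-monoˡ-≤-nonNeg (+ suc q) bound ⟩
      + suc q * (M * + (k C suc m) * Y * N + s * (+ k * + suc a * t))
        ≡⟨ expand (+ suc q) M (+ (k C suc m)) Y N s (+ k) (+ suc a) t ⟩
      M * + (k C suc m) * (+ suc q * Y) * N + + suc a * (s * (+ k * + suc q * t))
        ≡⟨ cong (λ w → M * + (k C suc m) * w * N + + suc a * (s * (+ k * + suc q * t))) absorb ⟩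
      M * + (k C suc m) * (+ suc a * E) * N + + suc a * (s * (+ k * + suc q * t))
        ≡⟨ collect M (+ (k C suc m)) (+ suc a) E N (s * (+ k * + suc q * t)) ⟩
      + suc a * (M * + (k C suc m) * E * N + s * (+ k * + suc q * t)) ∎)
      where
      open ≤-Reasoning
      M = + suc m * + m
      N = ⟪ x , x ⟫
      E = + (suc q C suc a)
      X = + (q C j)
      Y = + (q C j')
      t = T (suc m) x x
      bal' : Balanced (x ∘ ∁)
      bal' = balanced-∁ (balanced-∑ L bal) bal
      L' : Level k' (x ∘ ∁)
      L' = level-∁ n≡ L
      k+2≤n : k ℕ.+ 2 ℕ.≤ n
      k+2≤n = subst (k ℕ.+ 2 ℕ.≤_) n≡ (ℕₚ.+-monoʳ-≤ k (ℕ.s≤s (ℕ.s≤s ℕ.z≤n)))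
      k'+2≤n : k' ℕ.+ 2 ℕ.≤ n
      k'+2≤n = subst (k' ℕ.+ 2 ℕ.≤_) (trans (ℕₚ.+-comm k' k) n≡) (ℕₚ.+-monoʳ-≤ k' (ℕ.s≤s (ℕ.s≤s ℕ.z≤n)))
      module Z = Descent {n} {k} k+2≤n (supersetSum x) (∂-level L) (∑ₗ-zero 1 λ S e → cong₂ _*_ (bal S e) (bal S e))
      module W = Descent {n} {k'} k'+2≤n (supersetSum (x ∘ ∁)) (∂-level L') (∑ₗ-zero 1 λ S e → cong₂ _*_ (bal' S e) (bal' S e))
      q≡j+b : q ≡ j ℕ.+ b
      q≡j+b = ℕₚ.+-cancelˡ-≡ (suc m ℕ.+ 2) q (j ℕ.+ b) (trans q≡ (trans (sym n≡) (trans (cong (ℕ._+ k') (sym k≡)) (assoc (suc m) j b))))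
        where
        assoc : ∀ m j b → m ℕ.+ j ℕ.+ suc (suc b) ≡ m ℕ.+ 2 ℕ.+ (j ℕ.+ b)
        assoc = ℕ-solve-∀
      q≡j'+a : q ≡ j' ℕ.+ a
      q≡j'+a = ℕₚ.+-cancelˡ-≡ (suc m ℕ.+ 2) q (j' ℕ.+ a) (trans q≡ (trans (sym n≡) (trans (cong (k ℕ.+_) (sym k'≡)) (assoc (suc m) j' a))))
        where
        assoc : ∀ m j a → suc (suc a) ℕ.+ (m ℕ.+ j) ≡ m ℕ.+ 2 ℕ.+ (j ℕ.+ a)
        assoc = ℕ-solve-∀
      X-pos : Positive X
      X-pos = positive (+<+ (ℕ.>-nonZero⁻¹ _ {{subst (λ s → ℕ.NonZero (s C j)) (sym q≡j+b) (C-nonZero j b)}}))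
      Y-pos : Positive Y
      Y-pos = positive (+<+ (ℕ.>-nonZero⁻¹ _ {{subst (λ s → ℕ.NonZero (s C j')) (sym q≡j'+a) (C-nonZero j' a)}}))
      exchange : + k * + suc a * + (k' C suc m) * X ≡ + k' * + suc b * + (k C suc m) * Y
      exchange = trans (push k (suc a) (k' C suc m) (q C j)) (trans (cong (λ s → + s)
        (subst (λ q → k ℕ.* suc a ℕ.* (k' C suc m) ℕ.* (q C j) ≡ k' ℕ.* suc b ℕ.* (k C suc m) ℕ.* (q C j')) (sym q≡j+b)
          (C-exchange (suc m) j j' a b k≡ k'≡ (trans (sym q≡j+b) q≡j'+a))))
        (sym (push k' (suc b) (k C suc m) (q C j'))))
        where
        push : ∀ a b c d → + a * + b * + c * + d ≡ + (a ℕ.* b ℕ.* c ℕ.* d)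
        push a b c d = sym (trans (pos-* (a ℕ.* b ℕ.* c) d) (cong (_* + d) (trans (pos-* (a ℕ.* b) c) (cong (_* + c) (pos-* a b)))))
      absorb : + suc q * Y ≡ + suc a * E
      absorb = trans (sym (pos-* (suc q) (q C j'))) (trans (cong (λ s → + s)
        (subst (λ q → suc q ℕ.* (q C j') ≡ suc a ℕ.* (suc q C suc a)) (sym q≡j'+a) (C-absorbʳ j' a))) (pos-* (suc a) (suc q C suc a)))
      bound : 0ℤ ≤ M * + (k C suc m) * Y * N + s * (+ k * + suc a * t)
      bound = am-gm X Y {{X-pos}} {{Y-pos}} M (+ (k C suc m)) (+ (k' C suc m)) (+ k * + suc a) (+ k' * + suc b) N
        (norm (suc m) (supersetSum x)) (norm (suc m) (supersetSum (x ∘ ∁))) t s s²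
        (≤-trans (Z.norm-bound j m q k≡ q≡) (≤-reflexive (cong (M * + (k C suc m) * X *_) (norm-supersetSum L))))
        (≤-trans (W.norm-bound j' m q k'≡ q≡) (≤-reflexive (cong (M * + (k' C suc m) * Y *_) (trans (norm-supersetSum L') (∑-∁ λ S → x S * x S)))))
        exchange
        (≤-trans (∑ₗ-square (suc m) Y (s * X) (supersetSum x) (supersetSum (x ∘ ∁))) (≤-reflexive
          (cong (λ w → Y * Y * norm (suc m) (supersetSum x) + + 2 * Y * (s * X) * w + (s * X) * (s * X) * norm (suc m) (supersetSum (x ∘ ∁)))
            (∑ₗ-cong (suc m) λ S _ → cong (supersetSum x S *_) (sym (subsetSum-∁ x S))))))
      expand : ∀ q M C Y N s k a t → q * (M * C * Y * N + s * (k * a * t)) ≡ M * C * (q * Y) * N + a * (s * (k * q * t))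
      expand = solve-∀
      collect : ∀ M C a E N u → M * C * (a * E) * N + a * u ≡ a * (M * C * E * N + u)
      collect = solve-∀

  -- Stars and the orthogonal decomposition of a weight

  ind-level-weight : ∀ {n} k (y : Weight n) → Level k (λ S → ind S k * y S)
  ind-level-weight k y A with ind-level k A
  ... | inj₁ e = inj₁ e
  ... | inj₂ z = inj₂ (trans (cong (_* y A) z) (*-zeroˡ (y A)))

  module Stars {n a b : ℕ} (n≡ : suc (suc a) ℕ.+ suc (suc b) ≡ n) where

    private
      k  = suc (suc a)
      k' = suc (suc b)

    star : Vec ℤ n → Weight n
    star c S = ind S k * lin c S

    star-∁ : ∀ c A → star c (∁ A) ≡ lin c ⊤ * ind A k' + - 1ℤ * (ind A k' * lin c A)
    star-∁ c A = trans (cong₂ _*_ (ind-∁ k k' n≡ A) (lin-of-∁ c A)) (expand (ind A k') (lin c ⊤) (lin c A))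
      where
      expand : ∀ i s l → i * (s + - 1ℤ * l) ≡ s * i + - 1ℤ * (i * l)
      expand = solve-∀

    -- Counting a k-set by the k' elements that it omits keeps the lower indices independent of m.
    -- Of the k-sets containing S, an element of S lies in C(r+1, k') and any other element in C(r,
    -- k'); Pascal's rule gives the difference.
    supersetSum-star : ∀ c m r → suc m ℕ.+ suc r ≡ n → ∀ S → ∣ S ∣ ≡ suc m →
      supersetSum (star c) S ≡ lin c ⊤ * + (r C k') + + (r C suc b) * lin c S
    supersetSum-star c m r e S s = begin
      supersetSum (star c) S
        ≡⟨ supersetSum-∁ (star c) S ⟩
      subsetSum (star c ∘ ∁) (∁ S)
        ≡⟨ subsetSum-cong (star-∁ c) (∁ S) ⟩
      subsetSum (λ A → σ * ind A k' + - 1ℤ * (ind A k' * lin c A)) (∁ S)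
        ≡⟨ trans (subsetSum-+ (λ A → σ * ind A k') (λ A → - 1ℤ * (ind A k' * lin c A)) (∁ S))
             (cong₂ _+_ (subsetSum-* σ (λ A → ind A k') (∁ S)) (subsetSum-* (- 1ℤ) (λ A → ind A k' * lin c A) (∁ S))) ⟩
      σ * subsetSum (λ A → ind A k') (∁ S) + - 1ℤ * subsetSum (λ A → ind A k' * lin c A) (∁ S)
        ≡⟨ cong₂ (λ u v → σ * u + - 1ℤ * v) (subsetSum-ind k' (∁ S)) (subsetSum-ind-lin (suc b) c (∁ S)) ⟩
      σ * + (∣ ∁ S ∣ C k') + - 1ℤ * (+ (pred ∣ ∁ S ∣ C suc b) * lin c (∁ S))
        ≡⟨ cong₂ (λ u l → σ * + (u C k') + - 1ℤ * (+ (pred u C suc b) * l)) (∣∁S∣≡ S e s) (lin-of-∁ c S) ⟩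
      σ * + (suc r C k') + - 1ℤ * (+ (r C suc b) * (σ + - 1ℤ * lin c S))
        ≡⟨ cong (λ u → σ * u + - 1ℤ * (+ (r C suc b) * (σ + - 1ℤ * lin c S))) (sym (+pascal r (suc b))) ⟩
      σ * (+ (r C suc b) + + (r C k')) + - 1ℤ * (+ (r C suc b) * (σ + - 1ℤ * lin c S))
        ≡⟨ simplify σ (+ (r C suc b)) (+ (r C k')) (lin c S) ⟩
      σ * + (r C k') + + (r C suc b) * lin c S ∎
      where
      open ≡-Reasoning
      σ = lin c ⊤
      simplify : ∀ s p q l → s * (p + q) + - 1ℤ * (p * (s + - 1ℤ * l)) ≡ s * q + p * l
      simplify = solve-∀

    disjointSum-star : ∀ c m r → suc m ℕ.+ suc r ≡ n → ∀ S → ∣ S ∣ ≡ suc m →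
      disjointSum (star c) S ≡ + (r C suc a) * lin c ⊤ + - (+ (r C suc a)) * lin c S
    disjointSum-star c m r e S s = begin
      subsetSum (star c) (∁ S)                        ≡⟨ subsetSum-ind-lin (suc a) c (∁ S) ⟩
      + (pred ∣ ∁ S ∣ C suc a) * lin c (∁ S)          ≡⟨ cong₂ (λ u l → + (pred u C suc a) * l) (∣∁S∣≡ S e s) (lin-of-∁ c S) ⟩
      + (r C suc a) * (lin c ⊤ + - 1ℤ * lin c S)      ≡⟨ expand (+ (r C suc a)) (lin c ⊤) (lin c S) ⟩
      + (r C suc a) * lin c ⊤ + - (+ (r C suc a)) * lin c S ∎
      where
      open ≡-Reasoning
      expand : ∀ p s l → p * (s + - 1ℤ * l) ≡ p * s + - p * l
      expand = solve-∀

    T-starʳ : {x : Weight n} → Level k x → ∀ c m r → suc m ℕ.+ suc r ≡ n →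
      T (suc m) x (star c) ≡ + (r C suc a) * (+ (k C suc m) * (lin c ⊤ * ∑ x) - + (suc a C m) * ⟪ x , lin c ⟫)
    T-starʳ {x} L c m r e = trans
      (∑ₗ-cong (suc m) λ S s → cong (supersetSum x S *_) (disjointSum-star c m r e S s))
      (trans (∑ₗ-supersetSum-affine L m (+ (r C suc a) * lin c ⊤) (- (+ (r C suc a))) c)
        (collect (+ (r C suc a)) (lin c ⊤) (+ (k C suc m)) (∑ x) (+ (suc a C m)) ⟪ x , lin c ⟫))
      where
      collect : ∀ E s p t q l → E * s * p * t + - E * q * l ≡ E * (p * (s * t) - q * l)
      collect = solve-∀

    -- The superset sums of the star are affine in `lin c S`, and the disjoint sums of `x` are
    -- superset sums of `x ∘ ∁`, which is balanced as well and so orthogonal to constants and to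
    -- `lin c`.
    T-starˡ : {x : Weight n} → Level k x → Balanced x → ∀ c m r → suc m ℕ.+ suc r ≡ n →
      T (suc m) (star c) x ≡ 0ℤ
    T-starˡ {x} L bal c m r e = begin
      T (suc m) (star c) x
        ≡⟨ ∑ₗ-cong (suc m) (λ S s → trans (cong₂ _*_ (supersetSum-star c m r e S s) (subsetSum-∁ x S)) (*-comm _ (supersetSum (x ∘ ∁) S))) ⟩
      ∑ₗ (suc m) (λ S → supersetSum (x ∘ ∁) S * (α + β * lin c S))
        ≡⟨ ∑ₗ-supersetSum-affine L' m α β c ⟩
      α * + (k' C suc m) * ∑ (x ∘ ∁) + β * + (suc b C m) * ⟪ x ∘ ∁ , lin c ⟫
        ≡⟨ cong₂ (λ u v → α * + (k' C suc m) * u + β * + (suc b C m) * v) ∑≡0 (balanced-lin (balanced-∁ (balanced-∑ L bal) bal) c) ⟩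
      α * + (k' C suc m) * 0ℤ + β * + (suc b C m) * 0ℤ
        ≡⟨ cong₂ _+_ (*-zeroʳ (α * + (k' C suc m))) (*-zeroʳ (β * + (suc b C m))) ⟩
      0ℤ ∎
      where
      open ≡-Reasoning
      α = lin c ⊤ * + (r C k')
      β = + (r C suc b)
      L' : Level k' (x ∘ ∁)
      L' = level-∁ n≡ L
      ∑≡0 : ∑ (x ∘ ∁) ≡ 0ℤ
      ∑≡0 = trans (∑-∁ x) (balanced-∑ L bal)

    -- The scaled orthogonal decomposition P f = ξ + ℓ, with ℓ in the span of the stars and ξ balanced;
    -- R = C(n - 2, k - 1) and X = C(n - 2, k - 2).
    module Projection {f : Weight n} (L : Level k f) where

      R X P : ℤ
      R = + (suc (suc (a ℕ.+ b)) C suc b)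
      X = + (suc (suc (a ℕ.+ b)) C k')
      P = R * (R + X)

      -- The solution of the linear system that makes `ξ` balanced: at the singleton of i the
      -- superset sum of `star c` is `lin c ⊤ * X` plus `R` times the i-th entry of `c`, and this
      -- has to be `P` times the degree of i.
      c : Vec ℤ n
      c = Vec.map (λ d → (R + X) * d - X * ∑ f) (degrees f)

      ℓ ξ : Weight n
      ℓ = star c
      ξ S = P * f S + - 1ℤ * ℓ S

      split : ∀ S → P * f S ≡ ξ S + ℓ S
      split S = add-sub (P * f S) (ℓ S)
        where
        add-sub : ∀ p l → p ≡ p + - 1ℤ * l + l
        add-sub = solve-∀

      ξ-level : Level k ξ
      ξ-level A with L A | ind-level-weight k (lin c) A
      ... | inj₁ e | _      = inj₁ e
      ... | inj₂ _ | inj₁ e = inj₁ e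
      ... | inj₂ z | inj₂ w = inj₂ (trans (cong₂ (λ u v → P * u + - 1ℤ * v) z w) (zeros P))
        where
        zeros : ∀ P → P * 0ℤ + - 1ℤ * 0ℤ ≡ 0ℤ
        zeros = solve-∀

      -- (k - 1) C(n - 2, k - 1) = (n - k) C(n - 2, k - 2)
      R-X : + suc a * R ≡ + k' * X
      R-X = trans (sym (pos-* (suc a) (suc (suc (a ℕ.+ b)) C suc b))) (trans (cong (λ s → + s) shift) (pos-* k' (suc (suc (a ℕ.+ b)) C k')))
        where
        shift : suc a ℕ.* (suc (suc (a ℕ.+ b)) C suc b) ≡ k' ℕ.* (suc (suc (a ℕ.+ b)) C k')
        shift = subst (λ s → suc a ℕ.* (s C suc b) ≡ k' ℕ.* (s C k')) (cong (λ s → suc (suc s)) (ℕₚ.+-comm b a)) (sym (C-shift (suc b) a))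

      ∣⊤∣ : ∀ n → ∣ ⊤ {n} ∣ ≡ n
      ∣⊤∣ zero    = refl
      ∣⊤∣ (suc n) = cong suc (∣⊤∣ n)

      σ≡ : lin c ⊤ ≡ R * ∑ f
      σ≡ = begin
        lin c ⊤
          ≡⟨ lin-affine (R + X) (X * ∑ f) (degrees f) ⊤ ⟩
        (R + X) * lin (degrees f) ⊤ - X * ∑ f * + ∣ ⊤ {n} ∣
          ≡⟨ cong₂ (λ u v → (R + X) * u - X * ∑ f * + v) degree-sum (trans (∣⊤∣ n) (sym n≡)) ⟩
        (R + X) * (+ k * ∑ f) - X * ∑ f * (+ k + + k')
          ≡⟨ expand R X (+ suc a) (+ k') (∑ f) ⟩
        R * ∑ f + (+ suc a * R - + k' * X) * ∑ f
          ≡⟨ cong (λ u → R * ∑ f + (u - + k' * X) * ∑ f) R-X ⟩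
        R * ∑ f + (+ k' * X - + k' * X) * ∑ f
          ≡⟨ cancel (R * ∑ f) (+ k' * X) (∑ f) ⟩
        R * ∑ f ∎
        where
        open ≡-Reasoning
        degree-sum : lin (degrees f) ⊤ ≡ + k * ∑ f
        degree-sum = trans (lin-degrees-⊤ f) (trans (∑-cong λ A → trans (level-cong L A (cong λ s → + s)) (*-comm (f A) (+ k))) (∑-* (+ k) f))
        expand : ∀ R X a k' t → (R + X) * ((1ℤ + a) * t) - X * t * ((1ℤ + a) + k') ≡ R * t + (a * R - k' * X) * t
        expand = solve-∀
        cancel : ∀ u v t → u + (v - v) * t ≡ u
        cancel = solve-∀

      ξ-balanced : Balanced ξ
      ξ-balanced S s = begin
        supersetSum ξ S
          ≡⟨ trans (supersetSum-+ (λ A → P * f A) (λ A → - 1ℤ * ℓ A) S) (cong₂ _+_ (supersetSum-* P f S) (supersetSum-* (- 1ℤ) ℓ S)) ⟩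
        P * z + - 1ℤ * supersetSum ℓ S
          ≡⟨ cong (λ u → P * z + - 1ℤ * u) (supersetSum-star c 0 (suc (suc (a ℕ.+ b))) n-2 S s) ⟩
        P * z + - 1ℤ * (lin c ⊤ * X + R * lin c S)
          ≡⟨ cong₂ (λ u v → P * z + - 1ℤ * (u * X + R * v)) σ≡ lin-c ⟩
        P * z + - 1ℤ * (R * ∑ f * X + R * ((R + X) * z - X * ∑ f * 1ℤ))
          ≡⟨ vanish R X z (∑ f) ⟩
        0ℤ ∎
        where
        open ≡-Reasoning
        z = supersetSum f S
        n-2 : 2 ℕ.+ suc (suc (a ℕ.+ b)) ≡ n
        n-2 = trans (assoc a b) n≡
          where
          assoc : ∀ a b → 2 ℕ.+ suc (suc (a ℕ.+ b)) ≡ suc (suc a) ℕ.+ suc (suc b)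
          assoc = ℕ-solve-∀
        lin-c : lin c S ≡ (R + X) * z - X * ∑ f * 1ℤ
        lin-c = trans (lin-affine (R + X) (X * ∑ f) (degrees f) S) (cong₂ (λ u v → (R + X) * u - X * ∑ f * + v) (lin-degrees f S s) s)
        vanish : ∀ R X z t → R * (R + X) * z + - 1ℤ * (R * t * X + R * ((R + X) * z - X * t * 1ℤ)) ≡ 0ℤ
        vanish = solve-∀

      -- `ξ` is orthogonal to `ℓ`. The star part is kept as a pairing with `f`, which cancels in
      -- `T-≤` against the same pairing from `T-split` and never has to be evaluated.
      ⟪⟫-split : P * P * ⟪ f , f ⟫ ≡ ⟪ ξ , ξ ⟫ + P * ⟪ f , lin c ⟫
      ⟪⟫-split = begin
        P * P * ⟪ f , f ⟫
          ≡⟨ ∑-* (P * P) (λ S → f S * f S) ⟨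
        ∑ (λ S → P * P * (f S * f S))
          ≡⟨ ∑-cong (λ S → expand P (f S) (ind S k) (lin c S)) ⟩
        ∑ (λ S → ξ S * ξ S + (ind S k * (ξ S * lin c S) + P * (ind S k * (f S * lin c S))))
          ≡⟨ trans (∑-+ (λ S → ξ S * ξ S) (λ S → ind S k * (ξ S * lin c S) + P * (ind S k * (f S * lin c S))))
               (+-congˡ ⟪ ξ , ξ ⟫ (trans (∑-+ (λ S → ind S k * (ξ S * lin c S)) (λ S → P * (ind S k * (f S * lin c S))))
                 (+-congˡ (∑ₗ k (λ S → ξ S * lin c S)) (∑-* P (λ S → ind S k * (f S * lin c S)))))) ⟩
        ⟪ ξ , ξ ⟫ + (∑ₗ k (λ S → ξ S * lin c S) + P * ∑ₗ k (λ S → f S * lin c S))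
          ≡⟨ cong₂ (λ u v → ⟪ ξ , ξ ⟫ + (u + P * v)) (trans (∑ₗ-level ξ-level (lin c)) (balanced-lin ξ-balanced c)) (∑ₗ-level L (lin c)) ⟩
        ⟪ ξ , ξ ⟫ + (0ℤ + P * ⟪ f , lin c ⟫)
          ≡⟨ +-congˡ ⟪ ξ , ξ ⟫ (+-identityˡ _) ⟩
        ⟪ ξ , ξ ⟫ + P * ⟪ f , lin c ⟫ ∎
        where
        open ≡-Reasoning
        expand : ∀ P f i l → P * P * (f * f) ≡ (P * f + - 1ℤ * (i * l)) * (P * f + - 1ℤ * (i * l))
          + (i * ((P * f + - 1ℤ * (i * l)) * l) + P * (i * (f * l)))
        expand = solve-∀

      -- Splitting the right argument leaves `T f ℓ`, which `T-starʳ` evaluates for every `f`.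
      -- Splitting the left argument of `T f ξ` then leaves `T ξ ξ`, since `T ℓ ξ` vanishes.
      T-split : ∀ m r → suc m ℕ.+ suc r ≡ n → P * P * T (suc m) f f
        ≡ T (suc m) ξ ξ + P * (+ (r C suc a) * (+ (k C suc m) * (lin c ⊤ * ∑ f) - + (suc a C m) * ⟪ f , lin c ⟫))
      T-split m r e = begin
        P * P * T (suc m) f f
          ≡⟨ *-assoc P P _ ⟩
        P * (P * T (suc m) f f)
          ≡⟨ cong (P *_) (trans (scaleʳ f) (+-comm (T (suc m) f ξ) (T (suc m) f ℓ))) ⟩
        P * (T (suc m) f ℓ + T (suc m) f ξ)
          ≡⟨ *-distribˡ-+ P (T (suc m) f ℓ) _ ⟩
        P * T (suc m) f ℓ + P * T (suc m) f ξ
          ≡⟨ cong₂ (λ u v → P * u + v) (T-starʳ L c m r e) (trans (scaleˡ ξ) (trans (+-congˡ (T (suc m) ξ ξ) (T-starˡ ξ-level ξ-balanced c m r e)) (+-identityʳ _))) ⟩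
        P * (+ (r C suc a) * (+ (k C suc m) * (lin c ⊤ * ∑ f) - + (suc a C m) * ⟪ f , lin c ⟫)) + T (suc m) ξ ξ
          ≡⟨ +-comm (P * (+ (r C suc a) * (+ (k C suc m) * (lin c ⊤ * ∑ f) - + (suc a C m) * ⟪ f , lin c ⟫))) _ ⟩
        T (suc m) ξ ξ + P * (+ (r C suc a) * (+ (k C suc m) * (lin c ⊤ * ∑ f) - + (suc a C m) * ⟪ f , lin c ⟫)) ∎
        where
        open ≡-Reasoning
        superset-split : ∀ S → P * supersetSum f S ≡ supersetSum ξ S + supersetSum ℓ S
        superset-split S = trans (sym (supersetSum-* P f S)) (trans (supersetSum-cong split S) (supersetSum-+ ξ ℓ S))
        disjoint-split : ∀ S → P * disjointSum f S ≡ disjointSum ξ S + disjointSum ℓ S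
        disjoint-split S = trans (sym (subsetSum-* P f (∁ S))) (trans (subsetSum-cong split (∁ S)) (subsetSum-+ ξ ℓ (∁ S)))
        scaleʳ : ∀ y → P * T (suc m) y f ≡ T (suc m) y ξ + T (suc m) y ℓ
        scaleʳ y = trans (sym (∑ₗ-* (suc m) P (λ S → supersetSum y S * disjointSum f S)))
          (trans (∑ₗ-cong (suc m) λ S _ → trans (swap P (supersetSum y S) (disjointSum f S))
              (trans (cong (supersetSum y S *_) (disjoint-split S)) (*-distribˡ-+ (supersetSum y S) _ _)))
            (∑ₗ-+ (suc m) (λ S → supersetSum y S * disjointSum ξ S) (λ S → supersetSum y S * disjointSum ℓ S)))
          where
          swap : ∀ p x y → p * (x * y) ≡ x * (p * y)
          swap = solve-∀
        scaleˡ : ∀ y → P * T (suc m) f y ≡ T (suc m) ξ y + T (suc m) ℓ y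
        scaleˡ y = trans (sym (∑ₗ-* (suc m) P (λ S → supersetSum f S * disjointSum y S)))
          (trans (∑ₗ-cong (suc m) λ S _ → trans (sym (*-assoc P (supersetSum f S) (disjointSum y S)))
              (trans (cong (_* disjointSum y S) (superset-split S)) (*-distribʳ-+ (disjointSum y S) (supersetSum ξ S) _)))
            (∑ₗ-+ (suc m) (λ S → supersetSum ξ S * disjointSum y S) (λ S → supersetSum ℓ S * disjointSum y S)))

      P-positive : Positive P
      P-positive = positive-* R-positive (+-positive R-positive)
        where
        R-positive : Positive R
        R-positive = +C-positive (suc b) (suc a) (cong suc (trans (ℕₚ.+-suc b a) (cong suc (ℕₚ.+-comm b a))))
        +-positive : Positive R → Positive (R + X)
        +-positive p = positive (subst (_< R + X) (+-identityˡ 0ℤ) (+-mono-<-≤ (positive⁻¹ R {{p}}) (+≤+ ℕ.z≤n)))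

      -- With t = suc m, Et = C(n - t - 1, k - 1), Ek = C(n - k - 1, k - 1) and f replaced by a star, the form
      -- Ek Et C(k - 1, t) ⟪f,f⟫ - Ek T t f f + Et C(k, t) T k f f vanishes, so it may be evaluated at ξ.
      -- There T-bound applies to both T t and T k; nₜ and nₖ are n - t - 1 and n - k - 1.
      T-≤ : T k f f ≡ 0ℤ → a ℕ.≤ b → ∀ m j → suc m ℕ.+ suc j ≡ k →
        ∀ j' q → suc m ℕ.+ j' ≡ k' → suc m ℕ.+ 2 ℕ.+ q ≡ n →
        k ℕ.* suc a ℕ.+ suc m ℕ.* m ℕ.≤ suc j ℕ.* suc b →
        T (suc m) f f ≤ + (suc q C suc a) * + (suc a C suc m) * ⟪ f , f ⟫
      T-≤ Tk≡0 a≤b m j k≡ j' q k'≡ q≡ cond = *-cancelˡ-≤-pos _ _ Z {{Z-positive}} (0≤i-j⇒j≤i (begin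
        0ℤ
          -- The third summand is the surplus of the main term over the two error terms. As k
          -- C(k-1,t) = (k-t) C(k,t), its sign is that of (k-t) nₜ nₖ - nₜ k(k-1) - nₖ t(t-1),
          -- written as nₜ times the slack of `cond` plus t(t-1) (nₜ - nₖ).
          ≤⟨ +-mono-≤ (+-mono-≤ (nonNegative-* (nonNegative-* {Ek} {nₖ} (+≤+ ℕ.z≤n) (+≤+ ℕ.z≤n)) boundA)
                                (nonNegative-* (nonNegative-* (nonNegative-* {Et} {Ct} (+≤+ ℕ.z≤n) (+≤+ ℕ.z≤n)) (+≤+ ℕ.z≤n)) boundB))
                      (nonNegative-* (nonNegative-* (nonNegative-* (nonNegative-* {Ek} {Et} (+≤+ ℕ.z≤n) (+≤+ ℕ.z≤n)) (+≤+ ℕ.z≤n)) N≥0)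
                                     (+-mono-≤ (nonNegative-* {nₜ} (+≤+ ℕ.z≤n) (i≤j⇒0≤j-i cond′)) (nonNegative-* M≥0 (i≤j⇒0≤j-i nₖ≤nₜ)))) ⟩
        Ek * nₖ * (M * Ct * Et * N + - 1ℤ * (kℤ * nₜ * Tt)) + Et * Ct * nₜ * (kℤ * + suc a * 1ℤ * Ek * N + 1ℤ * (kℤ * nₖ * Tk))
          + Ek * Et * Ct * N * (nₜ * (k-t * nₖ - (kℤ * + suc a + M)) + M * (nₜ - nₖ))
          ≡⟨ ring₁ Ek nₖ M Ct Et N kℤ nₜ Tt (+ suc a) Tk k-t ⟩
        Ek * Et * nₜ * nₖ * N * (k-t * Ct) - kℤ * nₜ * nₖ * Ek * Tt + kℤ * nₜ * nₖ * Et * Ct * Tk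
          ≡⟨ cong (λ u → Ek * Et * nₜ * nₖ * N * u - kℤ * nₜ * nₖ * Ek * Tt + kℤ * nₜ * nₖ * Et * Ct * Tk) (sym absorb) ⟩
        Ek * Et * nₜ * nₖ * N * (kℤ * C₁) - kℤ * nₜ * nₖ * Ek * Tt + kℤ * nₜ * nₖ * Et * Ct * Tk
          -- Adding the star part passes from `ξ` to `f`. The terms in `u` cancel between `T t` and
          -- `T k`, which dictates the coefficient `Et * Ct`; the terms in `l` leave the defect
          -- `Ct - (C₀ + C₁)` of Pascal's rule.
          ≡⟨ ring₂ Ek nₖ Et N kℤ nₜ Tt Tk P C₀ C₁ u l Ct ⟩
        kℤ * nₜ * nₖ * (Ek * Et * C₁ * (N + P * l) - Ek * (Tt + P * (Et * (Ct * u - C₀ * l))) + Et * Ct * (Tk + P * (Ek * (1ℤ * u - 1ℤ * l))))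
          + kℤ * nₜ * nₖ * P * Ek * Et * l * (Ct - (C₀ + C₁))
          ≡⟨ cong₂ _+_ (cong₂ (λ x y → kℤ * nₜ * nₖ * (Ek * Et * C₁ * x - Ek * y + Et * Ct * (Tk + P * (Ek * (1ℤ * u - 1ℤ * l)))))
                          (sym ⟪⟫-split) (sym (T-split m (suc q) n-t-1)))
               (trans (cong (λ x → kℤ * nₜ * nₖ * P * Ek * Et * l * (x - (C₀ + C₁))) (sym (+pascal (suc a) m))) (vanish (kℤ * nₜ * nₖ * P * Ek * Et * l) (C₀ + C₁))) ⟩
        kℤ * nₜ * nₖ * (Ek * Et * C₁ * (P * P * ⟪ f , f ⟫) - Ek * (P * P * T (suc m) f f) + Et * Ct * (Tk + P * (Ek * (1ℤ * u - 1ℤ * l)))) + 0ℤ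
          ≡⟨ cong (λ x → kℤ * nₜ * nₖ * (Ek * Et * C₁ * (P * P * ⟪ f , f ⟫) - Ek * (P * P * T (suc m) f f) + Et * Ct * x) + 0ℤ) T-k ⟩
        kℤ * nₜ * nₖ * (Ek * Et * C₁ * (P * P * ⟪ f , f ⟫) - Ek * (P * P * T (suc m) f f) + Et * Ct * 0ℤ) + 0ℤ
          ≡⟨ ring₃ kℤ nₜ nₖ Ek Et C₁ P ⟪ f , f ⟫ (T (suc m) f f) Ct ⟩
        Z * (Et * C₁ * ⟪ f , f ⟫) - Z * T (suc m) f f ∎))
        where
        open ≤-Reasoning
        Ek = + (suc b C suc a)
        Et = + (suc q C suc a)
        Ct = + (k C suc m)
        C₀ = + (suc a C m)
        C₁ = + (suc a C suc m)
        kℤ = + k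
        nₜ = + suc q
        nₖ = + suc b
        k-t  = + suc j
        M  = + suc m * + m
        N  = ⟪ ξ , ξ ⟫
        Tt = T (suc m) ξ ξ
        Tk = T k ξ ξ
        u  = lin c ⊤ * ∑ f
        l  = ⟪ f , lin c ⟫
        Z  = kℤ * nₜ * nₖ * Ek * (P * P)
        d  = b ℕ.∸ a
        a+d≡b : a ℕ.+ d ≡ b
        a+d≡b = ℕₚ.m+[n∸m]≡n a≤b
        n-t-1 : suc m ℕ.+ suc (suc q) ≡ n
        n-t-1 = trans (sym (ℕₚ.+-assoc (suc m) 2 q)) q≡
        t+j≡ : suc m ℕ.+ j ≡ suc a
        t+j≡ = ℕₚ.suc-injective (trans (sym (ℕₚ.+-suc (suc m) j)) k≡)
        b≤q : b ℕ.≤ q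
        b≤q = ℕₚ.+-cancelˡ-≤ (suc m ℕ.+ 2) b q (ℕₚ.≤-trans (ℕₚ.≤-trans (ℕₚ.+-monoˡ-≤ b (ℕₚ.+-monoˡ-≤ 2 {suc m} {k} (ℕₚ.≤-trans (ℕₚ.m≤m+n (suc m) (suc j)) (ℕₚ.≤-reflexive k≡)))) (ℕₚ.≤-reflexive (ℕₚ.+-assoc k 2 b))) (ℕₚ.≤-reflexive (trans n≡ (sym q≡))))
        nₖ≤nₜ : nₖ ≤ nₜ
        nₖ≤nₜ = +≤+ (ℕ.s≤s b≤q)
        N≥0 : 0ℤ ≤ N
        N≥0 = ∑-≥0 λ S → 0≤i*i (ξ S)
        M≥0 : 0ℤ ≤ M
        M≥0 = nonNegative-* {+ suc m} {+ m} (+≤+ ℕ.z≤n) (+≤+ ℕ.z≤n)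
        Z-positive : Positive Z
        Z-positive = positive-* {kℤ * nₜ * nₖ * Ek} (positive-* {kℤ * nₜ * nₖ} _ (+C-positive (suc a) d (cong suc a+d≡b))) (positive-* P-positive P-positive)
        cond′ : kℤ * + suc a + M ≤ k-t * nₖ
        cond′ = subst₂ _≤_ (trans (pos-+ (k ℕ.* suc a) (suc m ℕ.* m)) (cong₂ _+_ (pos-* k (suc a)) (pos-* (suc m) m))) (pos-* (suc j) (suc b)) (+≤+ cond)
        absorb : kℤ * C₁ ≡ k-t * Ct
        absorb = trans (sym (pos-* k (suc a C suc m))) (trans (cong (λ s → + s)
          (subst (λ s → suc s ℕ.* (s C suc m) ≡ suc j ℕ.* (suc s C suc m)) t+j≡ (trans (C-absorb (suc m) j) (C-shift (suc m) j)))) (pos-* (suc j) (k C suc m)))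
        boundA : 0ℤ ≤ M * Ct * Et * N + - 1ℤ * (kℤ * nₜ * Tt)
        boundA = T-bound n≡ ξ-level ξ-balanced m (suc j) j' q k≡ k'≡ q≡ (- 1ℤ) refl
        -- The case t = k, so that nothing is left to descend on the side of level k, while the side
        -- of level n - k descends d = n - 2k levels.
        boundB : 0ℤ ≤ kℤ * + suc a * 1ℤ * Ek * N + 1ℤ * (kℤ * nₖ * Tk)
        boundB = subst (λ w → 0ℤ ≤ kℤ * + suc a * + w * Ek * N + 1ℤ * (kℤ * nₖ * Tk)) (nCn≡1 k)
          (T-bound n≡ ξ-level ξ-balanced (suc a) 0 d b (ℕₚ.+-identityʳ k) (cong (λ s → suc (suc s)) a+d≡b) (trans (ℕₚ.+-assoc k 2 b) n≡) 1ℤ refl)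
        T-k : Tk + P * (Ek * (1ℤ * u - 1ℤ * l)) ≡ 0ℤ
        T-k = trans (sym (cong₂ (λ x y → Tk + P * (Ek * (+ x * u - + y * l))) (nCn≡1 k) (nCn≡1 (suc a))))
          (trans (sym (T-split (suc a) (suc b) n≡)) (trans (cong (P * P *_) Tk≡0) (*-zeroʳ (P * P))))
        vanish : ∀ w x → w * (x - x) ≡ 0ℤ
        vanish = solve-∀
        ring₁ : ∀ Ek nₖ M Ct Et N kℤ nₜ Tt a Tk k-t →
          Ek * nₖ * (M * Ct * Et * N + - 1ℤ * (kℤ * nₜ * Tt)) + Et * Ct * nₜ * (kℤ * a * 1ℤ * Ek * N + 1ℤ * (kℤ * nₖ * Tk))
            + Ek * Et * Ct * N * (nₜ * (k-t * nₖ - (kℤ * a + M)) + M * (nₜ - nₖ))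
          ≡ Ek * Et * nₜ * nₖ * N * (k-t * Ct) - kℤ * nₜ * nₖ * Ek * Tt + kℤ * nₜ * nₖ * Et * Ct * Tk
        ring₁ = solve-∀
        ring₂ : ∀ Ek nₖ Et N kℤ nₜ Tt Tk P C₀ C₁ u l Ct →
          Ek * Et * nₜ * nₖ * N * (kℤ * C₁) - kℤ * nₜ * nₖ * Ek * Tt + kℤ * nₜ * nₖ * Et * Ct * Tk
          ≡ kℤ * nₜ * nₖ * (Ek * Et * C₁ * (N + P * l) - Ek * (Tt + P * (Et * (Ct * u - C₀ * l))) + Et * Ct * (Tk + P * (Ek * (1ℤ * u - 1ℤ * l))))
            + kℤ * nₜ * nₖ * P * Ek * Et * l * (Ct - (C₀ + C₁))
        ring₂ = solve-∀
        ring₃ : ∀ kℤ nₜ nₖ Ek Et C₁ P g t Ct →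
          kℤ * nₜ * nₖ * (Ek * Et * C₁ * (P * P * g) - Ek * (P * P * t) + Et * Ct * 0ℤ) + 0ℤ
          ≡ kℤ * nₜ * nₖ * Ek * (P * P) * (Et * C₁ * g) - kℤ * nₜ * nₖ * Ek * (P * P) * t
        ring₃ = solve-∀

  -- Families of sets

  point : Subset n → Weight n
  point []          []          = 1ℤ
  point (false ∷ A) (false ∷ S) = point A S
  point (false ∷ A) (true ∷ S)  = 0ℤ
  point (true ∷ A)  (false ∷ S) = 0ℤ
  point (true ∷ A)  (true ∷ S)  = point A S

  indicator : Family n → Weight n
  indicator []      S = 0ℤ
  indicator (A ∷ F) S = point A S + indicator F S

  point-cases : ∀ (A S : Subset n) → (A ≡ S × point A S ≡ 1ℤ) ⊎ point A S ≡ 0ℤ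
  point-cases []          []          = inj₁ (refl , refl)
  point-cases (false ∷ A) (true ∷ S)  = inj₂ refl
  point-cases (true ∷ A)  (false ∷ S) = inj₂ refl
  point-cases (false ∷ A) (false ∷ S) with point-cases A S
  ... | inj₁ (refl , e) = inj₁ (refl , e)
  ... | inj₂ e          = inj₂ e
  point-cases (true ∷ A)  (true ∷ S)  with point-cases A S
  ... | inj₁ (refl , e) = inj₁ (refl , e)
  ... | inj₂ e          = inj₂ e

  -- A list without duplicates never adds two point masses at the same set.
  indicator-cases : {F : Family n} → IsSet F → ∀ S → (S ∈ F × indicator F S ≡ 1ℤ) ⊎ indicator F S ≡ 0ℤ
  indicator-cases []          S = inj₂ refl
  indicator-cases {F = A ∷ F} (A∉F ∷ u) S with point-cases A S | indicator-cases u S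
  ... | inj₂ e          | inj₁ (S∈F , e') = inj₁ (there S∈F , cong₂ _+_ e e')
  ... | inj₂ e          | inj₂ e'         = inj₂ (cong₂ _+_ e e')
  ... | inj₁ (refl , e) | inj₂ e'         = inj₁ (here refl , cong₂ _+_ e e')
  ... | inj₁ (refl , e) | inj₁ (S∈F , _)  = contradiction refl (All.lookup A∉F S∈F)

  ∑-0 : ∑ {n} (λ _ → 0ℤ) ≡ 0ℤ
  ∑-0 {n} = ∑-zero {n} λ _ → refl

  ∑-point : (A : Subset n) → ∑ (point A) ≡ 1ℤ
  ∑-point []          = refl
  ∑-point {suc n} (false ∷ A) = cong₂ _+_ (∑-point A) (∑-0 {n})
  ∑-point {suc n} (true ∷ A)  = cong₂ _+_ (∑-0 {n}) (∑-point A)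

  ∑-indicator : (F : Family n) → ∑ (indicator F) ≡ + length F
  ∑-indicator {n} []      = ∑-0 {n}
  ∑-indicator     (A ∷ F) = trans (∑-+ (point A) (indicator F)) (cong₂ _+_ (∑-point A) (∑-indicator F))

  supersetSum-0 : (S : Subset n) → supersetSum (λ _ → 0ℤ) S ≡ 0ℤ
  supersetSum-0 S = supersetSum-vanish (λ _ → 0ℤ) S λ _ _ → refl

  supersetSum-point-⊆ : (A S : Subset n) → S ⊆ A → supersetSum (point A) S ≡ 1ℤ
  supersetSum-point-⊆ []          []          s = refl
  supersetSum-point-⊆ (false ∷ A) (false ∷ S) s = cong₂ _+_ (supersetSum-point-⊆ A S (drop-∷-⊆ s)) (supersetSum-0 S)
  supersetSum-point-⊆ (true ∷ A)  (false ∷ S) s = cong₂ _+_ (supersetSum-0 S) (supersetSum-point-⊆ A S (drop-∷-⊆ s))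
  supersetSum-point-⊆ (true ∷ A)  (true ∷ S)  s = supersetSum-point-⊆ A S (drop-∷-⊆ s)
  supersetSum-point-⊆ (false ∷ A) (true ∷ S)  s with s Vec.here
  ... | ()

  supersetSum-point-⊈ : (A S : Subset n) → ¬ S ⊆ A → supersetSum (point A) S ≡ 0ℤ
  supersetSum-point-⊈ []          []          s = contradiction (λ {_} x → x) s
  supersetSum-point-⊈ (false ∷ A) (false ∷ S) s = cong₂ _+_ (supersetSum-point-⊈ A S (s ∘ out⊆)) (supersetSum-0 S)
  supersetSum-point-⊈ (true ∷ A)  (false ∷ S) s = cong₂ _+_ (supersetSum-0 S) (supersetSum-point-⊈ A S (s ∘ out⊆))
  supersetSum-point-⊈ (true ∷ A)  (true ∷ S)  s = supersetSum-point-⊈ A S (s ∘ s⊆s)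
  supersetSum-point-⊈ (false ∷ A) (true ∷ S)  s = supersetSum-0 S

  supersetSum-indicator : (F : Family n) → ∀ S → supersetSum (indicator F) S ≡ + degree F S
  supersetSum-indicator []      S = supersetSum-0 S
  supersetSum-indicator (A ∷ F) S with S ⊆? A
  ... | yes s = trans (supersetSum-+ (point A) (indicator F) S) (cong₂ _+_ (supersetSum-point-⊆ A S s) (supersetSum-indicator F S))
  ... | no ¬s = trans (supersetSum-+ (point A) (indicator F) S) (trans (cong₂ _+_ (supersetSum-point-⊈ A S ¬s) (supersetSum-indicator F S)) (+-identityˡ _))

  subsetSum-≥0 : {x : Weight n} → (∀ A → 0ℤ ≤ x A) → ∀ R → 0ℤ ≤ subsetSum x R
  subsetSum-≥0 h []          = h []
  subsetSum-≥0 h (false ∷ R) = subsetSum-≥0 (h ∘ (false ∷_)) R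
  subsetSum-≥0 h (true ∷ R)  = +-mono-≤ (subsetSum-≥0 (h ∘ (false ∷_)) R) (subsetSum-≥0 (h ∘ (true ∷_)) R)

  -- A k-set misses k' elements, so it is disjoint from C(k', t) sets of size t.
  ∑ₗ-disjointSum : ∀ {k k'} {x : Weight n} → k ℕ.+ k' ≡ n → Level k x → ∀ t →
    ∑ₗ t (disjointSum x) ≡ + (k' C t) * ∑ x
  ∑ₗ-disjointSum {k' = k'} {x} e L t = begin
    ∑ (λ S → ind S t * disjointSum x S)
      ≡⟨ ∑-cong (λ S → trans (*-comm (ind S t) _) (cong (_* ind S t) (subsetSum-∁ x S))) ⟩
    ∑ (λ S → supersetSum (x ∘ ∁) S * ind S t)
      ≡⟨ supersetSum-adjoint (x ∘ ∁) (λ S → ind S t) ⟩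
    ∑ (λ A → x (∁ A) * subsetSum (λ S → ind S t) A)
      ≡⟨ ∑-cong (λ A → trans (cong (x (∁ A) *_) (subsetSum-ind t A)) (trans (level-cong (level-∁ e L) A (cong λ s → + (s C t))) (*-comm (x (∁ A)) _))) ⟩
    ∑ (λ A → + (k' C t) * x (∁ A))
      ≡⟨ trans (∑-* (+ (k' C t)) (x ∘ ∁)) (cong (+ (k' C t) *_) (∑-∁ x)) ⟩
    + (k' C t) * ∑ x ∎
    where open ≡-Reasoning

  module _ {k : ℕ} {F : Family n} (set : IsSet F) (unif : Uniform k F) where

    indicator-level : Level k (indicator F)
    indicator-level A with indicator-cases set A
    ... | inj₁ (A∈F , _) = inj₁ (All.lookup unif A∈F)
    ... | inj₂ e         = inj₂ e

    indicator-≥0 : ∀ A → 0ℤ ≤ indicator F A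
    indicator-≥0 A with indicator-cases set A
    ... | inj₁ (_ , e) = ≤-trans (+≤+ ℕ.z≤n) (≤-reflexive (sym e))
    ... | inj₂ e       = ≤-reflexive (sym e)

    ⟪indicator⟫ : ⟪ indicator F , indicator F ⟫ ≡ + length F
    ⟪indicator⟫ = trans (∑-cong λ S → idem S (indicator-cases set S)) (∑-indicator F)
      where
      idem : ∀ S → (S ∈ F × indicator F S ≡ 1ℤ) ⊎ indicator F S ≡ 0ℤ → indicator F S * indicator F S ≡ indicator F S
      idem S (inj₁ (_ , e)) = trans (cong (_* indicator F S) e) (*-identityˡ _)
      idem S (inj₂ e)       = trans (cong (_* indicator F S) e) (sym e)

    -- On level k a superset sum is the value itself, so `T k` counts the disjoint pairs of members.
    T-intersecting : Intersecting F → T k (indicator F) (indicator F) ≡ 0ℤ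
    T-intersecting int = ∑ₗ-zero k λ S e → trans (cong (_* disjointSum f S) (supersetSum-level indicator-level S e)) (vanish S (indicator-cases set S))
      where
      f = indicator F
      vanish : ∀ S → (S ∈ F × f S ≡ 1ℤ) ⊎ f S ≡ 0ℤ → f S * disjointSum f S ≡ 0ℤ
      vanish S (inj₂ e)         = trans (cong (_* disjointSum f S) e) (*-zeroˡ (disjointSum f S))
      vanish S (inj₁ (S∈F , _)) = trans (cong (f S *_) (subsetSum-zero f (∁ S) none)) (*-zeroʳ (f S))
        where
        none : ∀ A → A ⊆ ∁ S → f A ≡ 0ℤ
        none A A⊆∁S with indicator-cases set A
        ... | inj₂ e         = e
        ... | inj₁ (A∈F , _) with int A∈F S∈F
        ...   | x , x∈A∩S with x∈p∩q⁻ A S x∈A∩S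
        ...     | x∈A , x∈S = contradiction x∈S (x∈∁p⇒x∉p (A⊆∁S x∈A))

    T-degree : ∀ {k'} t D → k ℕ.+ k' ≡ n → (∀ S → ∣ S ∣ ≡ t → D ℕ.≤ degree F S) →
      + D * (+ (k' C t) * + length F) ≤ T t (indicator F) (indicator F)
    T-degree {k'} t D e h = begin
      + D * (+ (k' C t) * + length F)
        ≡⟨ cong (+ D *_) (trans (∑ₗ-disjointSum e indicator-level t) (cong (+ (k' C t) *_) (∑-indicator F))) ⟨
      + D * ∑ₗ t (disjointSum f)
        ≡⟨ ∑ₗ-* t (+ D) (disjointSum f) ⟨
      ∑ₗ t (λ S → + D * disjointSum f S)
        ≤⟨ ∑ₗ-mono t (λ S s → *-monoʳ-≤-nonNeg (disjointSum f S) {{nonNegative (subsetSum-≥0 indicator-≥0 (∁ S))}}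
             (≤-trans (+≤+ (h S s)) (≤-reflexive (sym (supersetSum-indicator F S))))) ⟩
      T t f f ∎
      where
      open ≤-Reasoning
      f = indicator F

  -- Minimum degrees and the contradiction

  subset-of-size : ∀ {n} t → t ℕ.≤ n → ∃ λ (S : Subset n) → ∣ S ∣ ≡ t
  subset-of-size {zero}  zero    _ = [] , refl
  subset-of-size {suc n} zero    _ with subset-of-size {n} 0 ℕ.z≤n
  ... | S , e = false ∷ S , e
  subset-of-size {suc n} (suc t) (ℕ.s≤s le) with subset-of-size t le
  ... | S , e = true ∷ S , cong suc e

  ∈-allSubsets : (S : Subset n) → S ∈ allSubsets n
  ∈-allSubsets []          = here refl
  ∈-allSubsets (false ∷ S) = ∈-++⁺ˡ (∈-map⁺ (false ∷_) (∈-allSubsets S))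
  ∈-allSubsets (true ∷ S)  = ∈-++⁺ʳ _ (∈-map⁺ (true ∷_) (∈-allSubsets S))

  minimum-≤ : ∀ {x xs} → x ∈ xs → minimum xs ℕ.≤ x
  minimum-≤ {xs = x ∷ []}     (here refl) = ℕₚ.≤-refl
  minimum-≤ {xs = x ∷ y ∷ xs} (here refl) = ℕₚ.m⊓n≤m x _
  minimum-≤ {xs = x ∷ y ∷ xs} (there i)   = ℕₚ.≤-trans (ℕₚ.m⊓n≤n x _) (minimum-≤ i)

  δₜ-≤ : (F : Family n) → ∀ {t} S → ∣ S ∣ ≡ t → δₜ t F ℕ.≤ degree F S
  δₜ-≤ F S e = minimum-≤ (∈-map⁺ (degree F) (∈-filter⁺ (λ S → ∣ S ∣ ℕ.≟ _) (∈-allSubsets S) e))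

  length-positive : (F : Family n) → ∀ {D} S → D ℕ.< degree F S → 0 ℕ.< length F
  length-positive (_ ∷ _) S _ = ℕ.s≤s ℕ.z≤n

  excess-impossible : ∀ D c l → ℕ.NonZero c → 0 ℕ.< l → ¬ (+ suc D * (+ c * + l) ≤ + D * (+ c * + l))
  excess-impossible D (suc c) (suc l) _ _ h = ℕₚ.1+n≰n (drop‿+≤+ (*-cancelʳ-≤-pos (+ suc D) (+ D) (+ suc c * + suc l) h))

  -- The parameters turn every difference into a sum: k = a + 2, n - k = b + 2, t = m + 1, k - t = j
  -- + 1, and hence n - t - 1 = j + (b + 2).
  δₜ-bound : ∀ {n a b m j} → suc (suc a) ℕ.+ suc (suc b) ≡ n → suc m ℕ.+ suc j ≡ suc (suc a) →
    suc (suc a) ℕ.* suc a ℕ.+ suc m ℕ.* m ℕ.≤ suc j ℕ.* suc b →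
    {F : Family n} → IsSet F → Uniform (suc (suc a)) F → Intersecting F →
    δₜ (suc m) F ℕ.≤ (j ℕ.+ suc (suc b)) C j
  δₜ-bound {n} {a} {b} {m} {j} n≡ k≡ cond {F} set unif int = ℕₚ.≮⇒≥ λ D<δ →
    excess-impossible D (k' C t) (length F) c≢0
      (length-positive F (proj₁ S₀) (ℕₚ.<-≤-trans D<δ (δₜ-≤ F (proj₁ S₀) (proj₂ S₀))))
      (begin
        + suc D * (+ (k' C t) * + length F)
          ≤⟨ T-degree set unif t (suc D) n≡ (λ S e → ℕₚ.≤-trans D<δ (δₜ-≤ F S e)) ⟩
        T t f f
          ≤⟨ Stars.Projection.T-≤ n≡ (indicator-level set unif) (T-intersecting set unif int) a≤b m j k≡ j' q k'≡ q≡ cond ⟩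
        + (suc q C suc a) * + (suc a C t) * ⟪ f , f ⟫
          ≡⟨ cong₂ _*_ trinomial (⟪indicator⟫ set unif) ⟩
        + D * + (k' C t) * + length F
          ≡⟨ *-assoc (+ D) (+ (k' C t)) _ ⟩
        + D * (+ (k' C t) * + length F) ∎)
    where
    open ≤-Reasoning
    t  = suc m
    k' = suc (suc b)
    D  = (j ℕ.+ k') C j
    f  = indicator F
    q  = suc j ℕ.+ b
    t+j≡ : t ℕ.+ j ≡ suc a
    t+j≡ = ℕₚ.suc-injective (trans (sym (ℕₚ.+-suc t j)) k≡)
    -- The condition gives k(k-1) ≤ (k-t)(n-k-1) ≤ (k-1)(n-k-1), and k - 1 is positive.
    k≤1+b : suc (suc a) ℕ.≤ suc b
    k≤1+b = ℕₚ.*-cancelˡ-≤ (suc a) (ℕₚ.≤-trans (ℕₚ.≤-reflexive (ℕₚ.*-comm (suc a) (suc (suc a))))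
      (ℕₚ.≤-trans (ℕₚ.m≤m+n (suc (suc a) ℕ.* suc a) (t ℕ.* m)) (ℕₚ.≤-trans cond (ℕₚ.*-monoˡ-≤ (suc b) (subst (suc j ℕ.≤_) t+j≡ (ℕ.s≤s (ℕₚ.m≤n+m j m)))))))
    a≤b : a ℕ.≤ b
    a≤b = ℕₚ.≤-trans (ℕₚ.n≤1+n a) (ℕ.s≤s⁻¹ k≤1+b)
    t≤k' : t ℕ.≤ k'
    t≤k' = ℕₚ.≤-trans (ℕₚ.m≤m+n t (suc j)) (ℕₚ.≤-trans (ℕₚ.≤-reflexive k≡) (ℕ.s≤s (ℕ.s≤s a≤b)))
    j' = k' ℕ.∸ t
    k'≡ : t ℕ.+ j' ≡ k'
    k'≡ = ℕₚ.m+[n∸m]≡n t≤k'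
    S₀ = subset-of-size {n} t (ℕₚ.≤-trans t≤k' (subst (k' ℕ.≤_) n≡ (ℕₚ.m≤n+m k' (suc (suc a)))))
    q≡ : t ℕ.+ 2 ℕ.+ q ≡ n
    q≡ = trans (assoc t (suc j) b) (trans (cong (ℕ._+ k') k≡) n≡)
      where
      assoc : ∀ t j b → t ℕ.+ 2 ℕ.+ (j ℕ.+ b) ≡ t ℕ.+ j ℕ.+ suc (suc b)
      assoc = ℕ-solve-∀
    c≢0 : ℕ.NonZero (k' C t)
    c≢0 = subst (λ s → ℕ.NonZero (s C t)) k'≡ (C-nonZero t j')
    trinomial : + (suc q C suc a) * + (suc a C t) ≡ + D * + (k' C t)
    trinomial = trans (sym (pos-* (suc q C suc a) (suc a C t))) (trans (cong (λ s → + s)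
      (trans (cong₂ (λ x y → (x C y) ℕ.* (y C t)) q+1 (sym t+j≡)) (trans (C-trinomial t j j') (cong (λ x → ((j ℕ.+ x) C j) ℕ.* (x C t)) k'≡)))) (pos-* D (k' C t)))
      where
      q+1 : suc q ≡ t ℕ.+ j ℕ.+ j'
      q+1 = trans (swap j b) (trans (cong (j ℕ.+_) (sym k'≡)) (swap′ t j j'))
        where
        swap : ∀ j b → suc (suc j ℕ.+ b) ≡ j ℕ.+ suc (suc b)
        swap = ℕ-solve-∀
        swap′ : ∀ t j j' → j ℕ.+ (t ℕ.+ j') ≡ t ℕ.+ j ℕ.+ j'
        swap′ = ℕ-solve-∀

  -- If every k-set had positive degree, `T-degree` with D = 1 would make `T k` positive.
  δₜ-zero : ∀ {n k k'} → k ℕ.+ k' ≡ n → k ℕ.≤ k' →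
    {F : Family n} → IsSet F → Uniform k F → Intersecting F → δₜ k F ℕ.≤ 0
  δₜ-zero {n} {k} {k'} n≡ k≤k' {F} set unif int = ℕₚ.≮⇒≥ λ 0<δ →
    excess-impossible 0 (k' C k) (length F) (subst (λ s → ℕ.NonZero (s C k)) (ℕₚ.m+[n∸m]≡n k≤k') (C-nonZero k (k' ℕ.∸ k)))
      (length-positive F (proj₁ S₀) (ℕₚ.<-≤-trans 0<δ (δₜ-≤ F (proj₁ S₀) (proj₂ S₀))))
      (≤-trans (T-degree set unif k 1 n≡ (λ S e → ℕₚ.≤-trans 0<δ (δₜ-≤ F S e)))
        (≤-reflexive (trans (T-intersecting set unif int) (sym (*-zeroˡ (+ (k' C k) * + length F))))))
    where
    S₀ = subset-of-size {n} k (subst (k ℕ.≤_) n≡ (ℕₚ.m≤m+n k k'))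

-- From the hypotheses on n to the quadratic condition

open import Data.Nat using (ℕ; _+_; _*_; _∸_; _≤_; _<_)
open import Data.Nat.Combinatorics using (_C_)
open import Data.Integer using (+_)
open import Data.Integer using () renaming (_-_ to _-ℤ_)
open import Data.Product using (_×_)
open import Data.Nat using (zero; suc; z≤n; s≤s)
open import Data.Nat.Properties
open import Data.Nat.Tactic.RingSolver using (solve-∀)
open import Data.Product using (∃; _,_)
open import Relation.Binary.PropositionalEquality using (_≡_; refl; sym; trans; cong; subst; subst₂)
open Weights using (δₜ-bound; δₜ-zero)

-- Here t = m + 1, J = k - t and b = n - k; the summand J on the left stands for the -1 in
-- (k-t)(n-k-1). Once k J is subtracted, the left side of the hypothesis exceeds that of the
-- conclusion by t² + 2tJ + 2t, the last polynomial in `slack`.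
degree-condition : ∀ m J b → 2 * (suc m + J) * J + 3 * suc m * (suc m + J) ≤ (suc m + J + b) * J →
  (suc m + J) * (m + J) + suc m * m + J ≤ J * b
degree-condition m J b h = +-cancelˡ-≤ ((suc m + J) * J) _ _ (≤-trans
  (m+n≤o⇒m≤o _ (≤-reflexive (slack m J)))
  (≤-trans h (≤-reflexive (expand (suc m + J) J b))))
  where
  slack : ∀ m J → (suc m + J) * J + ((suc m + J) * (m + J) + suc m * m + J)
    + (m * m + 4 * m + 3 + 2 * m * J + 2 * J) ≡ 2 * (suc m + J) * J + 3 * suc m * (suc m + J)
  slack = solve-∀
  expand : ∀ k J b → (k + b) * J ≡ k * J + J * b
  expand = solve-∀

theorem4 : (n k : ℕ) → 1 ≤ n → 1 ≤ k → (F : Family n) → IsSet F → Uniform k F → Intersecting F →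
    ((2 * k + 2 ≤ n → δ F ≤ binom (n ∸ 2) (+ k -ℤ + 2))
    × ((t : ℕ) → 1 ≤ t → t < k →
    2 * k * (k ∸ t) + 3 * t * k ≤ n * (k ∸ t) →
    δₜ t F ≤ (n ∸ t ∸ 1) C (k ∸ t ∸ 1)))
theorem4 n k 1≤n 1≤k F set unif int = degree-bound k 1≤k unif , t-degree-bound k unif
  where
  degree-bound : ∀ k → 1 ≤ k → Uniform k F → 2 * k + 2 ≤ n → δ F ≤ binom (n ∸ 2) (+ k -ℤ + 2)
  -- For k = 1 the lower index is -1, where `binom` is 0.
  degree-bound (suc zero)    _ unif h with m≤n⇒∃[o]m+o≡n h
  ... | r , n≡ = δₜ-zero {k = 1} {suc (suc (suc r))} n≡ (s≤s z≤n) set unif int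
  degree-bound (suc (suc a)) _ unif h with m≤n⇒∃[o]m+o≡n h
  -- For t = 1 the condition reads k(k-1) ≤ (k-1)(n-k-1), and here n - k - 1 = k + r + 1.
  ... | r , refl = subst (λ s → δ F ≤ s C a) (cong (_∸ 2) (split a r)) (δₜ-bound {a = a} {b = b} {m = 0} {j = a} (split a r) refl
        (≤-trans (≤-reflexive (+-identityʳ _)) (≤-trans (≤-reflexive (*-comm (suc (suc a)) (suc a))) (*-monoʳ-≤ (suc a) (m≤n⇒m≤1+n (m≤m+n (suc (suc a)) r))))) set unif int)
    where
    b = suc (suc a) + r
    split : ∀ a r → suc (suc a) + suc (suc (suc (suc a) + r)) ≡ 2 * suc (suc a) + 2 + r
    split = solve-∀
  t-degree-bound : ∀ k → Uniform k F → (t : ℕ) → 1 ≤ t → t < k → 2 * k * (k ∸ t) + 3 * t * k ≤ n * (k ∸ t) →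
    δₜ t F ≤ (n ∸ t ∸ 1) C (k ∸ t ∸ 1)
  t-degree-bound k unif (suc m) _ t<k h with m≤n⇒∃[o]m+o≡n t<k
  ... | j , refl = bound (m≤n⇒∃[o]m+o≡n 2k≤n)
    where
    K = suc (suc m + j)
    K≡ : suc m + suc j ≡ K
    K≡ = +-suc (suc m) j
    K∸t : K ∸ suc m ≡ suc j
    K∸t = trans (cong (_∸ suc m) (sym K≡)) (m+n∸m≡n (suc m) (suc j))
    h′ : 2 * K * suc j + 3 * suc m * K ≤ n * suc j
    h′ = subst (λ d → 2 * K * d + 3 * suc m * K ≤ n * d) K∸t h
    2k≤n : 2 * K ≤ n
    2k≤n = *-cancelʳ-≤ (2 * K) n (suc j) (m+n≤o⇒m≤o (2 * K * suc j) h′)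
    bound : (∃ λ r → 2 * K + r ≡ n) → δₜ (suc m) F ≤ (n ∸ suc m ∸ 1) C (K ∸ suc m ∸ 1)
    bound (r , n≡) = subst₂ (λ s d → δₜ (suc m) F ≤ s C (d ∸ 1)) size (sym K∸t)
      (δₜ-bound {a = m + j} {b = b} {m = m} {j = j} n≡′ K≡ condition set unif int)
      where
      b = m + j + r
      n≡′ : K + suc (suc b) ≡ n
      n≡′ = trans (double m j r) n≡
        where
        double : ∀ m j r → suc (suc m + j) + suc (suc (m + j + r)) ≡ 2 * suc (suc m + j) + r
        double = solve-∀
      condition : K * suc (m + j) + suc m * m ≤ suc j * suc b
      -- `degree-condition` is used with n - k = b + 2; cancelling one `suc j` lowers this factor to
      -- b + 1.
      condition = +-cancelʳ-≤ (suc j) _ _ (≤-trans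
        (subst (λ k → k * suc (m + j) + suc m * m + suc j ≤ suc j * suc (suc b)) K≡
          (subst (λ c → (suc m + suc j) * c + suc m * m + suc j ≤ suc j * suc (suc b)) (+-suc m j)
            (degree-condition m (suc j) (suc (suc b)) (subst₂ (λ k s → 2 * k * suc j + 3 * suc m * k ≤ s * suc j) (sym K≡) (trans (sym n≡′) (cong (_+ suc (suc b)) (sym K≡))) h′))))
        (≤-reflexive (trans (*-suc (suc j) (suc b)) (+-comm (suc j) (suc j * suc b)))))
      size : j + suc (suc b) ≡ n ∸ suc m ∸ 1
      size = trans (sym (m+n∸m≡n (suc (suc m)) (j + suc (suc b)))) (trans (cong (_∸ suc (suc m)) (trans (assoc m j (suc (suc b))) n≡′)) (shift n m))
        where
        assoc : ∀ m j c → suc (suc m) + (j + c) ≡ suc (suc m + j) + c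
        assoc = solve-∀
        shift : ∀ n m → n ∸ suc (suc m) ≡ n ∸ suc m ∸ 1
        shift n m = trans (cong (n ∸_) (+-comm 1 (suc m))) (sym (∸-+-assoc n (suc m) 1))
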